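{- Let $m\ge 2$ and let $H_1,\dots,H_k$ be complete graphs, each with at least two vertices. Then for every $n$, $\mathrm{ex}^{\mathrm{col}}(n,(H_1,\dots,H_k),K_m)=\max_{i\le k}\mathcal N(H_i,T_{m-1}(n))$; that is, the maximum of $\sum_{i=1}^k\mathcal N(H_i,G_i)$ over edge-colored $K_m$-free $n$-vertex graphs $G$ is attained by the Tur\'an graph $T_{m-1}(n)$ with all edges of a single color.
   Context: $T_{m-1}(n)$ is the complete $(m-1)$-partite graph on $n$ vertices with parts of size $\lfloor n/(m-1)\rfloor$ or $\lceil n/(m-1)\rceil$. $\mathcal N(H,G)$ is the number of subgraphs of $G$ isomorphic to $H$. For a graph $G$ whose edges are colored with colors $1,\dots,k$, $G_i$ is the subgraph of edges of color $i$; $\mathrm{ex}^{\mathrm{col}}(n,(H_1,\dots,H_k),F)$ is the maximum of $\sum_i\mathcal N(H_i,G_i)$ over all $F$-free $n$-vertex graphs $G$ and all such colorings. -}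

module Defs where

open import Data.Bool using (Bool; true; false; T; not; _∧_; if_then_else_)
open import Data.Bool.Properties using (T?) renaming (_≟_ to _≟ᵇ_)
open import Data.Empty using (⊥-elim)
open import Data.Fin using (Fin; toℕ; fromℕ<)
open import Data.Fin.Properties using (_≟_; all?; any?; toℕ<n; toℕ-injective; toℕ-fromℕ<)
open import Data.Fin.Subset using (Subset; _∈_)
open import Data.Fin.Subset.Properties using (_∈?_)
open import Data.List using (List; []; _∷_; _∷ʳ_; length; filter; cartesianProduct;
  cartesianProductWith; allFin; tabulate; applyUpTo; upTo)
open import Data.Nat.ListAction using (sum)
open import Data.List.Properties using (upTo-∷ʳ)
open import Data.List.Membership.Propositional as Mem using (lose)
open import Data.List.Membership.Propositional.Properties
  using (∈-cartesianProductWith⁺; ∈-cartesianProduct⁺; ∈-allFin)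
open import Data.List.Relation.Unary.All as All using ()
open import Data.List.Relation.Unary.AllPairs using ([]; _∷_)
open import Data.List.Relation.Unary.Any as Any using (here; there; satisfied)
open import Data.List.Relation.Unary.Unique.Propositional using (Unique)
open import Data.List.Relation.Unary.Unique.Propositional.Properties as Uniq using ()
open import Data.Nat using (ℕ; zero; suc; _+_; _*_; _∸_; _≤_; _<_; _<?_; s≤s; s≤s⁻¹; NonZero)
open import Data.Nat.DivMod using (_/_; _%_; _mod_; m≡m%n+[m/n]*n; m%n<n;
  [m+kn]%n≡m%n; m<n⇒m%n≡m; m<n⇒m/n≡0; +-distrib-/-∣ʳ; m*n/n≡m)
open import Data.Nat.Divisibility using (divides-refl)
open import Data.Nat.Properties using (+-comm; +-assoc; +-suc; +-identityʳ; <⇒≤; ≤-refl;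
  ≤-reflexive; m<n⇒m<1+n; <⇒≱; <-cmp; suc-pred)
open import Relation.Binary.Definitions using (tri<; tri≈; tri>)
open import Data.Product using (Σ; ∃; _×_; _,_; proj₁; proj₂)
open import Data.Sum using (_⊎_; inj₁; inj₂)
open import Data.Vec as Vec using (Vec; []; _∷_; lookup)
open import Data.Vec.Properties using (lookup∘tabulate; ∷-injective)
open import Function using (_∘_; id)
open import Relation.Binary.PropositionalEquality
open import Relation.Nullary using (¬_; Dec; yes; no; does)
open import Relation.Nullary.Decidable using (_×-dec_; _→-dec_; map′; dec-true; dec-false)

record Graph (n : ℕ) : Set where
  field
    adj    : Fin n → Fin n → Bool
    symm   : ∀ u v → adj u v ≡ adj v u
    irrefl : ∀ v → adj v v ≡ false

  Adj : Fin n → Fin n → Set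
  Adj u v = T (adj u v)

open Graph public

IsComplete : ∀ {n} → Graph n → Set
IsComplete G = ∀ u v → u ≢ v → Adj G u v

K : ∀ n → Graph n
K n .adj u v = not (does (u ≟ v))
K n .symm u v with u ≟ v | v ≟ u
... | yes _ | yes _ = refl
... | no _  | no _  = refl
... | yes p | no q  = ⊥-elim (q (sym p))
... | no p  | yes q = ⊥-elim (p (sym q))
K n .irrefl v = cong not (dec-true (v ≟ v) refl)

-- Candidate subgraphs: a vertex set and an adjacency matrix.  Using vectors
-- rather than functions makes two candidates propositionally equal exactly when
-- they have the same vertices and the same edges.
PreSubgraph : ℕ → Set
PreSubgraph n = Subset n × Vec (Vec Bool n) n

V : ∀ {n} → PreSubgraph n → Subset n
V = proj₁

edge : ∀ {n} → PreSubgraph n → Fin n → Fin n → Bool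
edge X u v = lookup (lookup (proj₂ X) u) v

record IsSubgraph {n} (G : Graph n) (X : PreSubgraph n) : Set where
  constructor isSubgraph
  field
    edge-sym  : ∀ u v → edge X u v ≡ edge X v u
    edge⊆G    : ∀ u v → T (edge X u v) → Adj G u v
    edge-ends : ∀ u v → T (edge X u v) → u ∈ V X × v ∈ V X

record IsIsomorphism {h n} (H : Graph h) (X : PreSubgraph n) (φ : Fin h → Fin n) : Set where
  constructor isIsomorphism
  field
    injective : ∀ i j → φ i ≡ φ j → i ≡ j
    into      : ∀ i → φ i ∈ V X
    onto      : ∀ v → v ∈ V X → ∃ λ i → φ i ≡ v
    edges     : ∀ i j → adj H i j ≡ edge X (φ i) (φ j)

_≅_ : ∀ {h n} → Graph h → PreSubgraph n → Set
H ≅ X = ∃ (IsIsomorphism H X)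

IsCopy : ∀ {h n} → Graph h → Graph n → PreSubgraph n → Set
IsCopy H G X = IsSubgraph G X × (H ≅ X)

Free : ∀ {f n} → Graph f → Graph n → Set
Free F G = ¬ (∃ (IsCopy F G))

allVecs : ∀ {A : Set} → List A → ∀ n → List (Vec A n)
allVecs xs zero    = [] ∷ []
allVecs xs (suc n) = cartesianProductWith _∷_ xs (allVecs xs n)

allBools : List Bool
allBools = true ∷ false ∷ []

allPreSubgraphs : ∀ n → List (PreSubgraph n)
allPreSubgraphs n = cartesianProduct (allVecs allBools n) (allVecs (allVecs allBools n) n)

∈-allVecs : ∀ {A : Set} {xs : List A} → (∀ x → x Mem.∈ xs) → ∀ {n} (v : Vec A n) → v Mem.∈ allVecs xs n
∈-allVecs all []      = here refl
∈-allVecs all (x ∷ v) = ∈-cartesianProductWith⁺ _∷_ (all x) (∈-allVecs all v)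

allVecs-unique : ∀ {A : Set} {xs : List A} → Unique xs → ∀ n → Unique (allVecs xs n)
allVecs-unique u zero    = All.[] ∷ []
allVecs-unique u (suc n) = Uniq.cartesianProductWith⁺ _∷_ ∷-injective u (allVecs-unique u n)

∈-allBools : ∀ b → b Mem.∈ allBools
∈-allBools true  = here refl
∈-allBools false = there (here refl)

allBools-unique : Unique allBools
allBools-unique = ((λ ()) All.∷ All.[]) ∷ All.[] ∷ []

∈-allPreSubgraphs : ∀ {n} (X : PreSubgraph n) → X Mem.∈ allPreSubgraphs n
∈-allPreSubgraphs (S , M) =
  ∈-cartesianProduct⁺ (∈-allVecs ∈-allBools S) (∈-allVecs (∈-allVecs ∈-allBools) M)

allPreSubgraphs-unique : ∀ n → Unique (allPreSubgraphs n)
allPreSubgraphs-unique n =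
  Uniq.cartesianProduct⁺ (allVecs-unique allBools-unique n)
    (allVecs-unique (allVecs-unique allBools-unique n) n)

isSubgraph? : ∀ {n} (G : Graph n) X → Dec (IsSubgraph G X)
isSubgraph? G X = map′ (λ (a , b , c) → isSubgraph a b c) (λ (isSubgraph a b c) → a , b , c)
  (     (all? λ u → all? λ v → edge X u v ≟ᵇ edge X v u)
  ×-dec (all? λ u → all? λ v → T? (edge X u v) →-dec T? (adj G u v))
  ×-dec (all? λ u → all? λ v → T? (edge X u v) →-dec ((u ∈? V X) ×-dec (v ∈? V X))))

isIsomorphism? : ∀ {h n} (H : Graph h) (X : PreSubgraph n) φ → Dec (IsIsomorphism H X φ)
isIsomorphism? H X φ =
  map′ (λ (a , b , c , d) → isIsomorphism a b c d) (λ (isIsomorphism a b c d) → a , b , c , d)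
  (     (all? λ i → all? λ j → (φ i ≟ φ j) →-dec (i ≟ j))
  ×-dec (all? λ i → φ i ∈? V X)
  ×-dec (all? λ v → (v ∈? V X) →-dec (any? λ i → φ i ≟ v))
  ×-dec (all? λ i → all? λ j → adj H i j ≟ᵇ edge X (φ i) (φ j)))

isIsomorphism-resp : ∀ {h n} {H : Graph h} {X : PreSubgraph n} {φ ψ} → φ ≗ ψ →
                     IsIsomorphism H X φ → IsIsomorphism H X ψ
isIsomorphism-resp {X = X} φ≗ψ (isIsomorphism a b c d) = isIsomorphism
  (λ i j p → a i j (trans (φ≗ψ i) (trans p (sym (φ≗ψ j)))))
  (λ i → subst (_∈ V X) (φ≗ψ i) (b i))
  (λ v v∈ → let (i , p) = c v v∈ in i , trans (sym (φ≗ψ i)) p)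
  (λ i j → trans (d i j) (cong₂ (edge X) (φ≗ψ i) (φ≗ψ j)))

_≅?_ : ∀ {h n} (H : Graph h) (X : PreSubgraph n) → Dec (H ≅ X)
_≅?_ {h} {n} H X = map′
  (λ p → let (φ , iso) = satisfied p in lookup φ , iso)
  (λ (φ , iso) → lose (∈-allVecs ∈-allFin (Vec.tabulate φ))
                      (isIsomorphism-resp (sym ∘ lookup∘tabulate φ) iso))
  (Any.any? (isIsomorphism? H X ∘ lookup) (allVecs (allFin n) h))

isCopy? : ∀ {h n} (H : Graph h) (G : Graph n) X → Dec (IsCopy H G X)
isCopy? H G X = isSubgraph? G X ×-dec (H ≅? X)

𝓝 : ∀ {h n} → Graph h → Graph n → ℕ
𝓝 {n = n} H G = length (filter (isCopy? H G) (allPreSubgraphs n))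

-- The values of colour on non-adjacent pairs are never used.
record EdgeColouring {n} (k : ℕ) (G : Graph n) : Set where
  field
    colour      : Fin n → Fin n → Fin k
    colour-symm : ∀ u v → Adj G u v → colour u v ≡ colour v u

open EdgeColouring public

colourClass : ∀ {n k} (G : Graph n) → EdgeColouring k G → Fin k → Graph n
colourClass G c i .adj u v = adj G u v ∧ does (colour c u v ≟ i)
colourClass G c i .symm u v with adj G u v in p | adj G v u in q
... | true  | true  = cong (λ a → does (a ≟ i)) (colour-symm c u v (subst T (sym p) _))
... | false | false = refl
... | true  | false with () ← trans (sym p) (trans (symm G u v) q)
... | false | true  with () ← trans (sym p) (trans (symm G u v) q)
colourClass G c i .irrefl v = cong (_∧ does (colour c v v ≟ i)) (irrefl G v)

monochromatic : ∀ {n k} (G : Graph n) → Fin k → EdgeColouring k G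
monochromatic G i .colour u v        = i
monochromatic G i .colour-symm u v _ = refl

colouredCount : ∀ {n k} {h : Fin k → ℕ} → (∀ i → Graph (h i)) →
                (G : Graph n) → EdgeColouring k G → ℕ
colouredCount H G c = sum (tabulate λ i → 𝓝 (H i) (colourClass G c i))

-- ex^col(n, (H₁, …, H_k), F) = M
record IsExCol (n : ℕ) {k f} {h : Fin k → ℕ} (H : ∀ i → Graph (h i)) (F : Graph f) (M : ℕ) : Set where
  field
    attained   : Σ (Graph n) λ G → Σ (EdgeColouring k G) λ c → Free F G × colouredCount H G c ≡ M
    upperBound : (G : Graph n) (c : EdgeColouring k G) → Free F G → colouredCount H G c ≤ M

⌊_/_⌋ ⌈_/_⌉ : ∀ n r .{{_ : NonZero r}} → ℕ
⌊ n / r ⌋ = n / r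
⌈ n / r ⌉ = (n + (r ∸ 1)) / r

partSize : ∀ {n r} → (Fin n → Fin r) → Fin r → ℕ
partSize {n} part j = length (filter (λ v → part v ≟ j) (allFin n))

-- T is the Turán graph T_r(n), up to isomorphism.  Parts may be empty, as they
-- must be when n < r.
record IsTurán (r : ℕ) .{{_ : NonZero r}} {n} (T : Graph n) : Set where
  field
    part     : Fin n → Fin r
    adj⇔     : ∀ u v → (Adj T u v → part u ≢ part v) × (part u ≢ part v → Adj T u v)
    balanced : ∀ j → partSize part j ≡ ⌊ n / r ⌋ ⊎ partSize part j ≡ ⌈ n / r ⌉

-- Every T_r(n) exists: put v in the part v mod r.
module _ (r : ℕ) .{{_ : NonZero r}} where

  residue : ∀ {n} → Fin n → Fin r
  residue v = toℕ v mod r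

  turán : ∀ n → Graph n
  turán n .adj u v = not (does (residue u ≟ residue v))
  turán n .symm u v with residue u ≟ residue v | residue v ≟ residue u
  ... | yes _ | yes _ = refl
  ... | no _  | no _  = refl
  ... | yes p | no q  = ⊥-elim (q (sym p))
  ... | no p  | yes q = ⊥-elim (p (sym q))
  turán n .irrefl v = cong not (dec-true (residue v ≟ residue v) refl)

  private
    ind : Bool → ℕ
    ind b = if b then 1 else 0

    class? : ∀ j x → Dec (x mod r ≡ j)
    class? j x = x mod r ≟ j

    count : Fin r → List ℕ → ℕ
    count j xs = length (filter (class? j) xs)

    count-∷ʳ : ∀ j xs x → count j (xs ∷ʳ x) ≡ count j xs + ind (does (class? j x))
    count-∷ʳ j [] x with does (class? j x)
    ... | true  = refl
    ... | false = refl
    count-∷ʳ j (y ∷ xs) x with does (class? j y)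
    ... | true  = cong suc (count-∷ʳ j xs x)
    ... | false = count-∷ʳ j xs x

    count-tabulate : ∀ j {n k} (g : Fin k → Fin n) (f : ℕ → ℕ) → (∀ i → toℕ (g i) ≡ f (toℕ i)) →
      length (filter (λ v → residue v ≟ j) (tabulate g)) ≡ count j (applyUpTo f k)
    count-tabulate j {k = zero}  g f eq = refl
    count-tabulate j {k = suc k} g f eq rewrite eq Fin.zero with does (class? j (f 0))
    ... | true  = cong suc (count-tabulate j (g ∘ Fin.suc) (f ∘ suc) (eq ∘ Fin.suc))
    ... | false = count-tabulate j (g ∘ Fin.suc) (f ∘ suc) (eq ∘ Fin.suc)

    toℕ-mod : ∀ q s → s < r → toℕ ((s + q * r) mod r) ≡ s
    toℕ-mod q s s<r = trans (toℕ-fromℕ< _) (trans ([m+kn]%n≡m%n s q r) (m<n⇒m%n≡m s<r))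

    mod-step : ∀ q s → s < r → ∀ j →
      ind (does (toℕ j <? s)) + ind (does (class? j (s + q * r))) ≡ ind (does (toℕ j <? suc s))
    mod-step q s s<r j with <-cmp (toℕ j) s
    ... | tri< j<s j≢s _
      rewrite dec-true (toℕ j <? s) j<s
            | dec-false (class? j (s + q * r)) (λ e → j≢s (trans (sym (cong toℕ e)) (toℕ-mod q s s<r)))
            | dec-true (toℕ j <? suc s) (m<n⇒m<1+n j<s) = refl
    ... | tri≈ j≮s j≡s _
      rewrite dec-false (toℕ j <? s) j≮s
            | dec-true (class? j (s + q * r)) (toℕ-injective (trans (toℕ-mod q s s<r) (sym j≡s)))
            | dec-true (toℕ j <? suc s) (s≤s (≤-reflexive j≡s)) = refl
    ... | tri> j≮s j≢s s<j
      rewrite dec-false (toℕ j <? s) j≮s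
            | dec-false (class? j (s + q * r)) (λ e → j≢s (trans (sym (cong toℕ e)) (toℕ-mod q s s<r)))
            | dec-false (toℕ j <? suc s) (λ j<1+s → <⇒≱ s<j (s≤s⁻¹ j<1+s)) = refl

    count-upTo : ∀ q s → s ≤ r → ∀ j →
      count j (upTo (s + q * r)) ≡ q + ind (does (toℕ j <? s))
    count-upTo zero    zero    _   j = refl
    count-upTo (suc q) zero    _   j = begin
      count j (upTo (r + q * r))      ≡⟨ count-upTo q r ≤-refl j ⟩
      q + ind (does (toℕ j <? r))     ≡⟨ cong (λ b → q + ind b) (dec-true (toℕ j <? r) (toℕ<n j)) ⟩
      q + 1                           ≡⟨ +-comm q 1 ⟩
      suc q                           ≡⟨ +-identityʳ (suc q) ⟨
      suc q + 0                       ∎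
      where open ≡-Reasoning
    count-upTo q       (suc s) s<r j = begin
      count j (upTo (suc x))                     ≡⟨ cong (count j) (upTo-∷ʳ x) ⟨
      count j (upTo x ∷ʳ x)                      ≡⟨ count-∷ʳ j (upTo x) x ⟩
      count j (upTo x) + ind (does (class? j x)) ≡⟨ cong (_+ ind (does (class? j x))) (count-upTo q s (<⇒≤ s<r) j) ⟩
      q + ind (does (toℕ j <? s)) + ind (does (class? j x)) ≡⟨ +-assoc q _ _ ⟩
      q + (ind (does (toℕ j <? s)) + ind (does (class? j x))) ≡⟨ cong (q +_) (mod-step q s s<r j) ⟩
      q + ind (does (toℕ j <? suc s))            ∎
      where
      open ≡-Reasoning
      x = s + q * r

    floor-size : ∀ q s → s < r → ⌊ (s + q * r) / r ⌋ ≡ q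
    floor-size q s s<r = begin
      (s + q * r) / r     ≡⟨ +-distrib-/-∣ʳ s (divides-refl q) ⟩
      s / r + q * r / r   ≡⟨ cong₂ _+_ (m<n⇒m/n≡0 s<r) (m*n/n≡m q r) ⟩
      q                   ∎
      where open ≡-Reasoning

    ceil-size : ∀ q s → suc s < r → ⌈ (suc s + q * r) / r ⌉ ≡ suc q
    ceil-size q s 1+s<r = trans (cong (_/ r) shuffle) (floor-size (suc q) s (<⇒≤ 1+s<r))
      where
      open ≡-Reasoning
      shuffle : suc s + q * r + (r ∸ 1) ≡ s + suc q * r
      shuffle = begin
        suc s + q * r + (r ∸ 1)     ≡⟨ +-suc (s + q * r) (r ∸ 1) ⟨
        s + q * r + suc (r ∸ 1)     ≡⟨ cong (s + q * r +_) (suc-pred r) ⟩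
        s + q * r + r               ≡⟨ +-assoc s (q * r) r ⟩
        s + (q * r + r)             ≡⟨ cong (s +_) (+-comm (q * r) r) ⟩
        s + suc q * r               ∎

    count-balanced : ∀ q s → s < r → ∀ j →
      count j (upTo (s + q * r)) ≡ ⌊ (s + q * r) / r ⌋ ⊎ count j (upTo (s + q * r)) ≡ ⌈ (s + q * r) / r ⌉
    count-balanced q s s<r j with toℕ j <? s
    ... | no j≮s = inj₁ (begin
      count j (upTo (s + q * r))  ≡⟨ count-upTo q s (<⇒≤ s<r) j ⟩
      q + ind (does (toℕ j <? s)) ≡⟨ cong (λ b → q + ind b) (dec-false (toℕ j <? s) j≮s) ⟩
      q + 0                       ≡⟨ +-identityʳ q ⟩
      q                           ≡⟨ floor-size q s s<r ⟨
      ⌊ (s + q * r) / r ⌋           ∎)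
      where open ≡-Reasoning
    count-balanced q (suc s) s<r j | yes j<s = inj₂ (begin
      count j (upTo (suc s + q * r))  ≡⟨ count-upTo q (suc s) (<⇒≤ s<r) j ⟩
      q + ind (does (toℕ j <? suc s)) ≡⟨ cong (λ b → q + ind b) (dec-true (toℕ j <? suc s) j<s) ⟩
      q + 1                           ≡⟨ +-comm q 1 ⟩
      suc q                           ≡⟨ ceil-size q s s<r ⟨
      ⌈ (suc s + q * r) / r ⌉           ∎)
      where open ≡-Reasoning

  turán-isTurán : ∀ n → IsTurán r (turán n)
  turán-isTurán n .IsTurán.part = residue
  turán-isTurán n .IsTurán.adj⇔ u v with residue u ≟ residue v
  ... | yes p = (λ ()) , (λ q → q p)
  ... | no  q = (λ _ → q) , _
  turán-isTurán n .IsTurán.balanced j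
    rewrite count-tabulate j {k = n} id id (λ _ → refl)
    = subst (λ x → count j (upTo x) ≡ ⌊ x / r ⌋ ⊎ count j (upTo x) ≡ ⌈ x / r ⌉)
            (sym (m≡m%n+[m/n]*n n r)) (count-balanced (n / r) (n % r) (m%n<n n r) j)

{-# OPTIONS --safe #-}

-- A copy of a complete graph is a clique, so the coloured count is a multilinear function of vertex weights,
-- evaluated at weight 1.  If u and v are not adjacent it is linear in the split of their joint weight, so all of
-- that weight can be moved to one of them (Motzkin–Straus); what remains is a weighted clique of G, on fewer
-- than m vertices.  On a clique, recolour p like q, or q like p, keeping the colour of the edge pq: the weight of
-- the cliques through both p and q cannot drop, so either the first recolouring loses nothing or the second one
-- gains strictly.  Finitely many such steps make all edges one colour i.  The count is then the elementary
-- symmetric polynomial of degree h i in the weights, and balancing the weights, padded with zeros, can only raise it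
-- to its value at the part sizes of the Turán graph.
module Submission where

open import Defs
open import Data.Bool using (Bool; true; false; T; if_then_else_; not; _∧_)
open import Data.Bool.Properties using (T?; ∧-identityʳ; ∧-zeroʳ)
open import Data.Empty using (⊥-elim)
open import Data.Fin using (Fin; zero; suc; fromℕ<)
open import Data.Fin.Properties using (_≟_; pigeonhole; <⇒≢)
import Data.Fin.Properties as Fin
import Data.Fin.Subset as Subset
open import Data.Fin.Subset.Properties using (_∈?_)
open import Data.List using (List; []; _∷_; _++_; map; filter; filterᵇ; length; tabulate; allFin; lookup;
  replicate)
open import Data.List.Extrema.Nat using (max; xs≤max; argmax-sel)
import Data.List.Membership.DecPropositional as DecMembership
open import Data.List.Membership.Propositional using (_∈_; _∉_; find)
open import Data.List.Membership.Propositional.Properties using (∈-allFin; ∈-map⁺; ∈-map⁻; ∈-++⁺ˡ; ∈-++⁺ʳ;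
  ∈-++⁻; ∈-filter⁺; ∈-filter⁻; ∈-lookup; ∈-tabulate⁺; ∈-tabulate⁻; ∈-∃++)
open import Data.List.Properties using (filter-all; filter-none; filter-accept; filter-reject; filter-idem;
  length-map; length-++; length-replicate; length-tabulate; length-take; map-id; map-∘; map-tabulate;
  tabulate-lookup)
open import Data.List.Relation.Binary.Permutation.Propositional as Perm using (_↭_; prep; swap; ↭-sym; ↭-refl;
  ↭-trans; ↭-reflexive; ↭⇒↭ₛ)
open import Data.List.Relation.Binary.Permutation.Propositional.Properties using (filter-↭; shift; map⁺;
  ↭-length; All-resp-↭; ∈-resp-↭)
import Data.List.Relation.Binary.Permutation.Setoid.Properties as PermS
open import Data.List.Relation.Binary.Sublist.Propositional as Sublist using (_⊆_; []; _∷_; _∷ʳ_; ⊆-trans;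
  minimum)
open import Data.List.Relation.Binary.Sublist.Propositional.Properties using (filter⁺; filter-⊆; All-resp-⊆)
open import Data.List.Relation.Unary.All as All using (All; []; _∷_; all?)
import Data.List.Relation.Unary.All.Properties as All
open import Data.List.Relation.Unary.AllPairs as AllPairs using (AllPairs; []; _∷_)
import Data.List.Relation.Unary.AllPairs.Properties as AllPairs
open import Data.List.Relation.Unary.Any as Any using (here; there)
open import Data.List.Relation.Unary.Any.Properties using (lookup-index)
open import Data.List.Relation.Unary.Unique.Propositional using (Unique)
open import Data.List.Relation.Unary.Unique.Propositional.Properties as Uniq using (allFin⁺; tabulate⁺;
  Unique[x∷xs]⇒x∉xs)
open import Data.Nat using (ℕ; zero; suc; _+_; _*_; _∸_; _≤_; _<_; _≤?_; z≤n; s≤s; s≤s⁻¹; NonZero; >-nonZero)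
open import Data.Nat.DivMod using (_/_; /-monoˡ-≤; +-distrib-/-∣ʳ; n/n≡1)
open import Data.Nat.Divisibility using (∣-refl)
open import Data.Nat.ListAction using (sum)
open import Data.Nat.ListAction.Properties using (sum-↭)
open import Data.Nat.Properties using (+-identityʳ; +-comm; +-assoc; +-suc; *-distribˡ-+; *-zeroʳ; ≤-refl;
  ≤-trans; ≤-reflexive; ≤-antisym; ≤-total; ≤-<-connex; ≤-<-trans; <-≤-trans; <⇒≤; <⇒≱; ≰⇒>; ≤-pred; n≤1+n;
  m≤m+n; m≤n+m; m∸n≤m; m∸n+n≡m; m+[n∸m]≡n; +-∸-assoc; m≤n⇒m∸n≡0; m≤n⇒m⊓n≡m; m<n⇒0<n∸m; suc-injective;
  +-cancelˡ-≡; +-cancelʳ-≤; +-mono-≤; +-monoˡ-≤; +-monoʳ-≤; +-monoˡ-<; +-monoʳ-<; *-monoˡ-≤; *-monoʳ-≤;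
  *-monoʳ-<; module ≤-Reasoning)
open import Data.Nat.Tactic.RingSolver using (solve-∀)
open import Data.Product using (Σ; ∃; ∃₂; ∃-syntax; _×_; _,_; proj₁; proj₂)
open import Data.Sum using (_⊎_; inj₁; inj₂)
open import Data.Vec as Vec using (Vec)
open import Data.Vec.Properties using ([]=⇒lookup; lookup⇒[]=; lookup∘tabulate; tabulate∘lookup;
  tabulate-cong)
open import Function using (_∘_; id; const; case_of_)
open import Relation.Binary.Definitions using (Decidable)
open import Relation.Binary.PropositionalEquality
open import Relation.Nullary using (¬_; Dec; yes; no; does; ¬?; _×-dec_)
open import Relation.Nullary.Decidable using (dec-true; dec-false)

-- Finite sums and list filters.

∑ : ∀ {k} → (Fin k → ℕ) → ℕ
∑ f = sum (tabulate f)

∑-cong : ∀ {k} {f g : Fin k → ℕ} → (∀ i → f i ≡ g i) → ∑ f ≡ ∑ g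
∑-cong {zero}  eq = refl
∑-cong {suc k} eq = cong₂ _+_ (eq zero) (∑-cong (eq ∘ suc))

∑-mono : ∀ {k} {f g : Fin k → ℕ} → (∀ i → f i ≤ g i) → ∑ f ≤ ∑ g
∑-mono {zero}  le = z≤n
∑-mono {suc k} le = +-mono-≤ (le zero) (∑-mono (le ∘ suc))

∑-+ : ∀ {k} (f g : Fin k → ℕ) → ∑ (λ i → f i + g i) ≡ ∑ f + ∑ g
∑-+ {zero}  f g = refl
∑-+ {suc k} f g =
  trans (cong (f zero + g zero +_) (∑-+ (f ∘ suc) (g ∘ suc)))
        (interchange (f zero) (g zero) (∑ (f ∘ suc)) (∑ (g ∘ suc)))
  where
  interchange : ∀ a b c d → a + b + (c + d) ≡ a + c + (b + d)
  interchange = solve-∀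

∑-* : ∀ {k} c (f : Fin k → ℕ) → ∑ (λ i → c * f i) ≡ c * ∑ f
∑-* {zero}  c f = sym (*-zeroʳ c)
∑-* {suc k} c f = trans (cong (c * f zero +_) (∑-* c (f ∘ suc))) (sym (*-distribˡ-+ c (f zero) _))

∑-zero : ∀ {k} {f : Fin k → ℕ} → (∀ i → f i ≡ 0) → ∑ f ≡ 0
∑-zero {zero}  f≡0 = refl
∑-zero {suc k} f≡0 = cong₂ _+_ (f≡0 zero) (∑-zero (f≡0 ∘ suc))

∑-single : ∀ {k} {f : Fin k → ℕ} i → (∀ j → j ≢ i → f j ≡ 0) → ∑ f ≡ f i
∑-single {f = f} zero    f≡0 =
  trans (cong (f zero +_) (∑-zero λ j → f≡0 (suc j) λ ())) (+-identityʳ _)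
∑-single {f = f} (suc i) f≡0 =
  trans (cong (_+ ∑ (f ∘ suc)) (f≡0 zero λ ())) (∑-single i λ j j≢i → f≡0 (suc j) (j≢i ∘ Fin.suc-injective))

filterᵇ-comm : {B : Set} (p q : B → Bool) → ∀ xs → filterᵇ p (filterᵇ q xs) ≡ filterᵇ q (filterᵇ p xs)
filterᵇ-comm p q []       = refl
filterᵇ-comm p q (x ∷ xs) with p x in px | q x in qx
... | true  | true  rewrite px | qx = cong (x ∷_) (filterᵇ-comm p q xs)
... | true  | false rewrite qx      = filterᵇ-comm p q xs
... | false | true  rewrite px      = filterᵇ-comm p q xs
... | false | false                 = filterᵇ-comm p q xs

filterᵇ-cong : {B : Set} {p q : B → Bool} → ∀ {xs} → All (λ x → p x ≡ q x) xs → filterᵇ p xs ≡ filterᵇ q xs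
filterᵇ-cong []                             = refl
filterᵇ-cong {p = p} {q} {x ∷ xs} (eq ∷ eqs) rewrite eq with q x
... | true  = cong (x ∷_) (filterᵇ-cong eqs)
... | false = filterᵇ-cong eqs

filterᵇ-map : {B C : Set} (p : B → Bool) (f : C → B) → ∀ xs → filterᵇ p (map f xs) ≡ map f (filterᵇ (p ∘ f) xs)
filterᵇ-map p f []       = refl
filterᵇ-map p f (x ∷ xs) with p (f x)
... | true  = cong (f x ∷_) (filterᵇ-map p f xs)
... | false = filterᵇ-map p f xs

∈-↭ : {B : Set} {x : B} → ∀ {xs} → x ∈ xs → ∃ λ ys → xs ↭ x ∷ ys
∈-↭ {x = x} x∈xs with ys , zs , refl ← ∈-∃++ x∈xs = ys ++ zs , shift x ys zs

-- Weighted clique counts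

nbrs : {B : Set} → (B → B → Bool) → B → List B → List B
nbrs a x = filterᵇ (a x)

-- The total weight, with multiplicative vertex weights w, of the h-cliques of a inside xs.
cw : {B : Set} → (B → B → Bool) → (B → ℕ) → ℕ → List B → ℕ
cw a w zero    xs       = 1
cw a w (suc h) []       = 0
cw a w (suc h) (x ∷ xs) = w x * cw a w h (nbrs a x xs) + cw a w (suc h) xs

-- The weight of the h-cliques that extend {p , q} inside R.
pairWeight : {B : Set} → (B → B → Bool) → (B → ℕ) → ℕ → B → B → List B → ℕ
pairWeight a w h p q R = if a p q then cw a w h (nbrs a q (nbrs a p R)) else 0

pairWeight-nonadjacent : {B : Set} (a : B → B → Bool) → ∀ w h p q R → a p q ≡ false →
  pairWeight a w h p q R ≡ 0
pairWeight-nonadjacent a w h p q R a≡f rewrite a≡f = refl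

-- The cliques split by whether they contain neither, exactly one or both of `p` and `q`. The
-- expansion exhibits the coefficients of `w p`, `w q` and `w p * w q`, on which merging and
-- recolouring act.
cw-∷∷ : {B : Set} (a : B → B → Bool) (w : B → ℕ) → ∀ h p q R →
  cw a w (2 + h) (p ∷ q ∷ R) ≡
  cw a w (2 + h) R + (w p * cw a w (1 + h) (nbrs a p R) + w q * cw a w (1 + h) (nbrs a q R))
    + w p * w q * pairWeight a w h p q R
cw-∷∷ a w h p q R with a p q
... | true  = rearrange (w p) (w q) _ _ _ _
  where
  rearrange : ∀ u v a b c d → u * (v * d + b) + (v * c + a) ≡ a + (u * b + v * c) + u * v * d
  rearrange = solve-∀
... | false = rearrange (w p) (w q) _ _ _
  where
  rearrange : ∀ u v a b c → u * b + (v * c + a) ≡ a + (u * b + v * c) + u * v * 0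
  rearrange = solve-∀

Symm : {B C : Set} → (B → B → C) → Set
Symm a = ∀ x y → a x y ≡ a y x

pairWeight-sym : {B : Set} {a : B → B → Bool} → Symm a → ∀ w h p q R →
  pairWeight a w h p q R ≡ pairWeight a w h q p R
pairWeight-sym {a = a} sy w h p q R
  rewrite sy p q | filterᵇ-comm (a q) (a p) R = refl

-- `cw` only looks from an entry to later ones, so independence of the order rests on the symmetry
-- of `a`. The swap is the substantial case: the expansion of `cw-∷∷` is symmetric in its two
-- leading entries.
cw-↭ : {B : Set} {a : B → B → Bool} → Symm a → ∀ w h {xs ys} → xs ↭ ys → cw a w h xs ≡ cw a w h ys
cw-↭ sy w zero    xs↭ys = refl
cw-↭ sy w (suc h) Perm.refl = refl
cw-↭ {a = a} sy w (suc h) (prep x xs↭ys) =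
  cong₂ _+_ (cong (w x *_) (cw-↭ sy w h (filter-↭ (T? ∘ a x) xs↭ys))) (cw-↭ sy w (suc h) xs↭ys)
cw-↭ sy w (suc zero) (swap x y xs↭ys) =
  trans (cong (λ z → w x * 1 + (w y * 1 + z)) (cw-↭ sy w 1 xs↭ys)) (rearrange (w x * 1) (w y * 1) _)
  where
  rearrange : ∀ a b c → a + (b + c) ≡ b + (a + c)
  rearrange = solve-∀
cw-↭ {a = a} sy w (suc (suc h)) (swap {xs} {ys} x y xs↭ys) = begin
  cw a w (2 + h) (x ∷ y ∷ xs)  ≡⟨ cw-∷∷ a w h x y xs ⟩
  cw a w (2 + h) xs + (w x * B xs x + w y * B xs y) + w x * w y * pairWeight a w h x y xs
    ≡⟨ cong₂ _+_ (cong₂ _+_ (cw-↭ sy w (suc (suc h)) xs↭ys)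
         (cong₂ _+_ (cong (w x *_) (cw-↭ sy w (suc h) (filter-↭ (T? ∘ a x) xs↭ys)))
                    (cong (w y *_) (cw-↭ sy w (suc h) (filter-↭ (T? ∘ a y) xs↭ys))))) (cong (w x * w y *_) pair) ⟩
  cw a w (2 + h) ys + (w x * B ys x + w y * B ys y) + w x * w y * pairWeight a w h y x ys
    ≡⟨ rearrange (w x) (w y) (cw a w (2 + h) ys) _ _ _ ⟩
  cw a w (2 + h) ys + (w y * B ys y + w x * B ys x) + w y * w x * pairWeight a w h y x ys
    ≡⟨ cw-∷∷ a w h y x ys ⟨
  cw a w (2 + h) (y ∷ x ∷ ys)  ∎
  where
  open ≡-Reasoning
  B = λ zs z → cw a w (1 + h) (nbrs a z zs)
  pair : pairWeight a w h x y xs ≡ pairWeight a w h y x ys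
  pair = trans (cong (λ z → if a x y then z else 0)
                 (cw-↭ sy w h (filter-↭ (T? ∘ a y) (filter-↭ (T? ∘ a x) xs↭ys))))
               (pairWeight-sym sy w h x y ys)
  rearrange : ∀ u v a b c d → a + (u * b + v * c) + u * v * d ≡ a + (v * c + u * b) + v * u * d
  rearrange = solve-∀
cw-↭ sy w (suc h) (Perm.trans p q) = trans (cw-↭ sy w (suc h) p) (cw-↭ sy w (suc h) q)

-- Only entries at different positions are ever compared, so on a duplicate-free list the diagonal
-- imposes no condition.
cw-cong : {B : Set} {a a′ : B → B → Bool} → ∀ w h {xs} → AllPairs (λ x y → a x y ≡ a′ x y) xs →
  cw a w h xs ≡ cw a′ w h xs
cw-cong w zero    _  = refl
cw-cong w (suc h) [] = refl
cw-cong {a = a} {a′} w (suc h) {x ∷ xs} (eq ∷ eqs) =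
  cong₂ (λ m n → w x * m + n)
    (trans (cw-cong w h (AllPairs.filter⁺ (T? ∘ a x) eqs)) (cong (cw a′ w h) (filterᵇ-cong eq)))
    (cw-cong w (suc h) eqs)

cw-map : {B C : Set} (f : C → B) (a : B → B → Bool) → ∀ w h xs →
  cw a w h (map f xs) ≡ cw (λ x y → a (f x) (f y)) (w ∘ f) h xs
cw-map f a w zero    xs       = refl
cw-map f a w (suc h) []       = refl
cw-map f a w (suc h) (x ∷ xs)
  rewrite cw-map f a w (suc h) xs
        | filterᵇ-map (a (f x)) f xs
        | cw-map f a w h (filterᵇ (a (f x) ∘ f) xs) = refl

cw-⊆ : {B : Set} (a : B → B → Bool) → ∀ w h {xs ys} → xs ⊆ ys → cw a w h xs ≤ cw a w h ys
cw-⊆ a w zero    _                = ≤-refl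
cw-⊆ a w (suc h) []               = z≤n
cw-⊆ a w (suc h) (y ∷ʳ xs⊆ys)     = ≤-trans (cw-⊆ a w (suc h) xs⊆ys) (m≤n+m _ _)
cw-⊆ a w (suc h) {x ∷ _} (refl ∷ xs⊆ys) =
  +-mono-≤ (*-monoʳ-≤ (w x) (cw-⊆ a w h (filter⁺ (T? ∘ a x) (T? ∘ a x) (λ { refl → id }) xs⊆ys)))
           (cw-⊆ a w (suc h) xs⊆ys)

cw-edgeless : {B : Set} {a : B → B → Bool} → ∀ w h {xs} → AllPairs (λ x y → a x y ≡ false) xs →
  cw a w (2 + h) xs ≡ 0
cw-edgeless w h []                   = refl
cw-edgeless {a = a} w h {x ∷ xs} (x∌ ∷ ∌)
  rewrite filter-none (T? ∘ a x) (All.map (subst T) x∌) | *-zeroʳ (w x) = cw-edgeless w h ∌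

-- The elementary symmetric polynomials.
e : ℕ → List ℕ → ℕ
e zero    ws       = 1
e (suc h) []       = 0
e (suc h) (w ∷ ws) = w * e h ws + e (suc h) ws

-- `e` is the count in which all pairs are adjacent. The bound holds for every colour class and
-- later caps the recolouring search.
cw≤e : {B : Set} (a : B → B → Bool) → ∀ w h xs → cw a w h xs ≤ e h (map w xs)
cw≤e a w zero    xs       = ≤-refl
cw≤e a w (suc h) []       = z≤n
cw≤e a w (suc h) (x ∷ xs) = +-mono-≤
  (*-monoʳ-≤ (w x) (≤-trans (cw-⊆ a w h (filter-⊆ (T? ∘ a x) xs)) (cw≤e a w h xs))) (cw≤e a w (suc h) xs)

cw-complete : {B : Set} {a : B → B → Bool} → ∀ w h {xs} → AllPairs (λ x y → T (a x y)) xs →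
  cw a w h xs ≡ e h (map w xs)
cw-complete w zero    _  = refl
cw-complete w (suc h) [] = refl
cw-complete {a = a} w (suc h) {x ∷ xs} (x∼ ∷ ∼)
  rewrite filter-all (T? ∘ a x) x∼ = cong₂ (λ m n → w x * m + n) (cw-complete w h ∼) (cw-complete w (suc h) ∼)

-- Merging non-adjacent vertices

-- The sizes have the form `2 + g i` so that the expansion at two entries holds in every colour and
-- a colour without edges contributes nothing.
total : ∀ {k} {B : Set} → (Fin k → B → B → Bool) → (B → ℕ) → (Fin k → ℕ) → List B → ℕ
total a w g xs = ∑ λ i → cw (a i) w (2 + g i) xs

-- The coefficient of `w p` in the total over `p ∷ R`; `codegree` below is that of `w p * w q`.
degree : ∀ {k} {B : Set} → (Fin k → B → B → Bool) → (B → ℕ) → (Fin k → ℕ) → B → List B → ℕ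
degree a w g p R = ∑ λ i → cw (a i) w (1 + g i) (nbrs (a i) p R)

codegree : ∀ {k} {B : Set} → (Fin k → B → B → Bool) → (B → ℕ) → (Fin k → ℕ) → B → B → List B → ℕ
codegree a w g p q R = ∑ λ i → pairWeight (a i) w (g i) p q R

total-∷ : ∀ {k} {B : Set} (a : Fin k → B → B → Bool) w g p R →
  total a w g (p ∷ R) ≡ w p * degree a w g p R + total a w g R
total-∷ a w g p R = trans (∑-+ (λ i → w p * cw (a i) w (1 + g i) (nbrs (a i) p R)) _)
                          (cong (_+ total a w g R) (∑-* (w p) λ i → cw (a i) w (1 + g i) (nbrs (a i) p R)))

total-∷∷ : ∀ {k} {B : Set} (a : Fin k → B → B → Bool) w g p q R →
  total a w g (p ∷ q ∷ R) ≡
  total a w g R + (w p * degree a w g p R + w q * degree a w g q R) + w p * w q * codegree a w g p q R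
total-∷∷ a w g p q R = begin
  total a w g (p ∷ q ∷ R)
    ≡⟨ ∑-cong (λ i → cw-∷∷ (a i) w (g i) p q R) ⟩
  ∑ (λ i → A i + (w p * P i + w q * Q i) + w p * w q * D i)
    ≡⟨ ∑-+ (λ i → A i + (w p * P i + w q * Q i)) _ ⟩
  ∑ (λ i → A i + (w p * P i + w q * Q i)) + ∑ (λ i → w p * w q * D i)
    ≡⟨ cong₂ _+_ (∑-+ A _) (∑-* (w p * w q) D) ⟩
  ∑ A + ∑ (λ i → w p * P i + w q * Q i) + w p * w q * ∑ D
    ≡⟨ cong (λ z → ∑ A + z + w p * w q * ∑ D)
            (trans (∑-+ (λ i → w p * P i) _) (cong₂ _+_ (∑-* (w p) P) (∑-* (w q) Q))) ⟩
  ∑ A + (w p * ∑ P + w q * ∑ Q) + w p * w q * ∑ D  ∎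
  where
  open ≡-Reasoning
  A = λ i → cw (a i) w (2 + g i) R
  P = λ i → cw (a i) w (1 + g i) (nbrs (a i) p R)
  Q = λ i → cw (a i) w (1 + g i) (nbrs (a i) q R)
  D = λ i → pairWeight (a i) w (g i) p q R

total-↭ : ∀ {k} {B : Set} {a : Fin k → B → B → Bool} → (∀ i → Symm (a i)) → ∀ w g {xs ys} → xs ↭ ys →
  total a w g xs ≡ total a w g ys
total-↭ sy w g xs↭ys = ∑-cong λ i → cw-↭ (sy i) w (2 + g i) xs↭ys

allPairs? : {B : Set} {R : B → B → Set} → Decidable R → ∀ xs →
  AllPairs R xs ⊎ ∃ λ p → ∃ λ q → ∃ λ ys → ¬ R p q × xs ↭ p ∷ q ∷ ys
allPairs? R? []       = inj₁ []
allPairs? R? (x ∷ xs) with all? (R? x) xs | allPairs? R? xs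
... | _      | inj₂ (p , q , ys , ¬Rpq , xs↭) =
  inj₂ (p , q , x ∷ ys , ¬Rpq , Perm.trans (prep x xs↭) (↭-sym (shift x (p ∷ q ∷ []) ys)))
... | yes Rx | inj₁ Rxs = inj₁ (Rx ∷ Rxs)
... | no ¬Rx | inj₁ _   with find (All.¬All⇒Any¬ (R? x) xs ¬Rx)
... | q , q∈xs , ¬Rxq   with ys , xs↭ ← ∈-↭ q∈xs = inj₂ (x , q , ys , ¬Rxq , prep x xs↭)

on₁ : {A : Set} → (A → A → Bool) → A × ℕ → A × ℕ → Bool
on₁ a x y = a (proj₁ x) (proj₁ y)

weightedTotal : ∀ {k} {A : Set} → (Fin k → A → A → Bool) → (Fin k → ℕ) → List (A × ℕ) → ℕ
weightedTotal a = total (on₁ ∘ a) proj₂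

-- Non-adjacency in every colour kills the `u * v` term. Only the degrees remain, and a single
-- vertex `r` of weight `u + v` has to match their weighted sum.
merge-bound : ∀ {k} {A : Set} (a : Fin k → A → A → Bool) g {p q} → (∀ i → a i p q ≡ false) → ∀ r u v R →
  u * degree (on₁ ∘ a) proj₂ g (p , u) R + v * degree (on₁ ∘ a) proj₂ g (q , v) R ≤
  u * degree (on₁ ∘ a) proj₂ g (r , u + v) R + v * degree (on₁ ∘ a) proj₂ g (r , u + v) R →
  weightedTotal a g ((p , u) ∷ (q , v) ∷ R) ≤ weightedTotal a g ((r , u + v) ∷ R)
merge-bound a g {p} {q} a≡f r u v R le = begin
  weightedTotal a g ((p , u) ∷ (q , v) ∷ R)
    ≡⟨ total-∷∷ (on₁ ∘ a) proj₂ g (p , u) (q , v) R ⟩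
  S + (u * deg (p , u) + v * deg (q , v)) + u * v * codegree (on₁ ∘ a) proj₂ g (p , u) (q , v) R
    ≡⟨ cong (λ z → S + (u * deg (p , u) + v * deg (q , v)) + u * v * z)
            (∑-zero λ i → pairWeight-nonadjacent (on₁ (a i)) proj₂ (g i) (p , u) (q , v) R (a≡f i)) ⟩
  S + (u * deg (p , u) + v * deg (q , v)) + u * v * 0
    ≤⟨ +-monoˡ-≤ _ (+-monoʳ-≤ S le) ⟩
  S + (u * deg (r , u + v) + v * deg (r , u + v)) + u * v * 0
    ≡⟨ rearrange u v _ S ⟩
  (u + v) * deg (r , u + v) + S
    ≡⟨ total-∷ (on₁ ∘ a) proj₂ g (r , u + v) R ⟨
  weightedTotal a g ((r , u + v) ∷ R)  ∎
  where
  open ≤-Reasoning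
  S = weightedTotal a g R
  deg = λ x → degree (on₁ ∘ a) proj₂ g x R
  rearrange : ∀ u v P S → S + (u * P + v * P) + u * v * 0 ≡ (u + v) * P + S
  rearrange = solve-∀

-- No clique contains two non-adjacent vertices, so the total is linear in the split of their joint weight.
merge : ∀ {k} {A : Set} (a : Fin k → A → A → Bool) g {p q} → (∀ i → a i p q ≡ false) → ∀ u v R →
  ∃ λ r → weightedTotal a g ((p , u) ∷ (q , v) ∷ R) ≤ weightedTotal a g ((r , u + v) ∷ R)
merge a g {p} {q} a≡f u v R
  with ≤-total (degree (on₁ ∘ a) proj₂ g (q , v) R) (degree (on₁ ∘ a) proj₂ g (p , u) R)
-- The degree of a vertex does not involve its own weight, so `(p , u)` and `(p , u + v)` have the
-- same degree and only the term of `v` changes.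
... | inj₁ Q≤P = p , merge-bound a g a≡f p u v R (+-monoʳ-≤ (u * _) (*-monoʳ-≤ v Q≤P))
... | inj₂ P≤Q = q , merge-bound a g a≡f q u v R (+-monoˡ-≤ (v * _) (*-monoʳ-≤ u P≤Q))

-- `positive` is kept because a recolouring must gain strictly when a degree rises, `mass` because
-- the balancing compares weight lists of equal sum.
record CliqueSupported {k} {A : Set} (adj : A → A → Bool) (a : Fin k → A → A → Bool) (g : Fin k → ℕ)
                       (xs : List (A × ℕ)) : Set where
  constructor cliqueSupported
  field
    support  : List (A × ℕ)
    clique   : AllPairs (λ x y → T (on₁ adj x y)) support
    positive : All (λ x → 0 < proj₂ x) support
    mass     : sum (map proj₂ support) ≡ sum (map proj₂ xs)
    gain     : weightedTotal a g xs ≤ weightedTotal a g support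

-- Each merge removes one entry, so recursion on the length reaches a list without non-adjacent
-- pairs. A merged weight is a sum of positive ones, hence positive.
concentrate : ∀ {k} {A : Set} (adj : A → A → Bool) (a : Fin k → A → A → Bool) g → (∀ i → Symm (a i)) →
  (∀ i p q → ¬ T (adj p q) → a i p q ≡ false) → ∀ xs → All (λ x → 0 < proj₂ x) xs →
  CliqueSupported adj a g xs
concentrate {A = A} adj a g sy a⇒adj xs = go (length xs) xs refl
  where
  go : ∀ n xs → length xs ≡ n → All (λ x → 0 < proj₂ x) xs → CliqueSupported adj a g xs
  step : ∀ n p u q v R {xs} → length xs ≡ suc n → xs ↭ (p , u) ∷ (q , v) ∷ R → ¬ T (adj p q) →
    All (λ x → 0 < proj₂ x) xs → CliqueSupported adj a g xs
  step n p u q v R {xs} len xs↭ ¬pq pos with All-resp-↭ xs↭ pos | merge a g (λ i → a⇒adj i p q ¬pq) u v R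
  ... | (s≤s _ ∷ _ ∷ posR) | r , le = record
    { CliqueSupported rec
    ; mass = trans (CliqueSupported.mass rec) (trans (+-assoc u v _) (sym (sum-↭ (map⁺ proj₂ xs↭))))
    ; gain = ≤-trans (≤-reflexive (total-↭ (λ i x y → sy i _ _) proj₂ g xs↭)) (≤-trans le (CliqueSupported.gain rec)) }
    where rec = go n ((r , u + v) ∷ R) (suc-injective (trans (sym (↭-length xs↭)) len)) (s≤s z≤n ∷ posR)
  go n xs len pos with allPairs? (λ x y → T? (on₁ adj x y)) xs
  ... | inj₁ clique = cliqueSupported xs clique pos refl ≤-refl
  go zero    [] len pos | inj₂ (_ , _ , _ , _ , xs↭) with () ← ↭-length xs↭
  go (suc n) xs len pos | inj₂ ((p , u) , (q , v) , R , ¬pq , xs↭) = step n p u q v R len xs↭ ¬pq pos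

-- Recolouring

Unique-resp-↭ : {B : Set} {xs ys : List B} → xs ↭ ys → Unique xs → Unique ys
Unique-resp-↭ xs↭ys = PermS.Unique-resp-↭ (setoid _) (↭⇒↭ₛ xs↭ys)

All⇒AllPairs : {B : Set} {P : B → Set} {R : B → B → Set} → (∀ {x y} → P x → P y → R x y) →
  ∀ {xs} → All P xs → AllPairs R xs
All⇒AllPairs f []         = []
All⇒AllPairs f (px ∷ pxs) = All.map (f px) pxs ∷ All⇒AllPairs f pxs

-- If `p` after the recolouring sees `R` as `q` did before, and pairs within `R` keep their status,
-- `p` inherits the clique weight of `q`. With `q` in place of `p` it says that `q` keeps its own.
twin-cw : {B : Set} (a a′ : B → B → Bool) → ∀ w h p {q R} → AllPairs (λ x y → a′ x y ≡ a x y) R →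
  All (λ y → a′ p y ≡ a q y) R → cw a′ w h (nbrs a′ p R) ≡ cw a w h (nbrs a q R)
twin-cw a a′ w h p agree twin =
  trans (cw-cong w h (AllPairs.filter⁺ (T? ∘ a′ p) agree)) (cong (cw a w h) (filterᵇ-cong twin))

-- After the recolouring `p` and `q` have the same neighbours in `R`, namely the former neighbours
-- of `q`, and these include the former common neighbours.
twin-pairWeight : {B : Set} {a a′ : B → B → Bool} → ∀ w h {p q R} → a′ p q ≡ a p q →
  AllPairs (λ x y → a′ x y ≡ a x y) R → All (λ y → a′ p y ≡ a q y) R → All (λ y → a′ q y ≡ a q y) R →
  pairWeight a w h p q R ≤ pairWeight a′ w h p q R
twin-pairWeight {a = a} {a′} w h {p} {q} {R} pq agree twinp twinq rewrite pq with a p q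
... | false = z≤n
... | true  = begin
  cw a w h (nbrs a q (nbrs a p R))     ≡⟨ cong (cw a w h) (filterᵇ-comm (a q) (a p) R) ⟩
  cw a w h (nbrs a p (nbrs a q R))     ≤⟨ cw-⊆ a w h (filter-⊆ (T? ∘ a p) (nbrs a q R)) ⟩
  -- Filtering twice by `a q` allows one filter to become the row of `q` in `a′` and the other the
  -- row of `p`.
  cw a w h (nbrs a q R)                ≡⟨ cong (cw a w h) (filter-idem (T? ∘ a q) R) ⟨
  cw a w h (nbrs a q (nbrs a q R))     ≡⟨ cong (cw a w h ∘ nbrs a q) (filterᵇ-cong twinq) ⟨
  cw a w h (nbrs a q (nbrs a′ q R))    ≡⟨ cong (cw a w h) (filterᵇ-comm (a q) (a′ q) R) ⟩
  cw a w h (nbrs a′ q (nbrs a q R))    ≡⟨ cong (cw a w h ∘ nbrs a′ q) (filterᵇ-cong twinp) ⟨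
  cw a w h (nbrs a′ q (nbrs a′ p R))
    ≡⟨ cw-cong w h (AllPairs.filter⁺ (T? ∘ a′ q) (AllPairs.filter⁺ (T? ∘ a′ p) agree)) ⟨
  cw a′ w h (nbrs a′ q (nbrs a′ p R))  ∎
  where open ≤-Reasoning

Colouring : ℕ → ℕ → Set
Colouring r k = Σ (Fin r → Fin r → Fin k) Symm

col : ∀ {r k} → Colouring r k → Fin r → Fin r → Fin k
col = proj₁

hue : ∀ {r k} → (Fin r → Fin r → Fin k) → Fin k → Fin r → Fin r → Bool
hue c i x y = does (c x y ≟ i)

-- Colour p as q, except that the edge pq keeps its colour.
copyᶜ : ∀ {r k} → Fin r → Fin r → (Fin r → Fin r → Fin k) → Fin r → Fin r → Fin k
copyᶜ p q c x y with x ≟ p | y ≟ p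
... | no _  | no _  = c x y
... | yes _ | yes _ = c p p
... | yes _ | no _  = if does (y ≟ q) then c p q else c q y
... | no _  | yes _ = if does (x ≟ q) then c q p else c x q

copyᶜ-symm : ∀ {r k} p q {c : Fin r → Fin r → Fin k} → Symm c → Symm (copyᶜ p q c)
copyᶜ-symm p q sy x y with x ≟ p | y ≟ p
... | no _  | no _  = sy x y
... | yes _ | yes _ = refl
... | yes _ | no _  = cong₂ (if does (y ≟ q) then_else_) (sy p q) (sy q y)
... | no _  | yes _ = cong₂ (if does (x ≟ q) then_else_) (sy q p) (sy x q)

copy : ∀ {r k} → Fin r → Fin r → Colouring r k → Colouring r k
copy p q (c , sy) = copyᶜ p q c , copyᶜ-symm p q sy

copy-other : ∀ {r k} {p q : Fin r} (c : Fin r → Fin r → Fin k) {x y} → x ≢ p → y ≢ p →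
  copyᶜ p q c x y ≡ c x y
copy-other {p = p} c {x} {y} x≢p y≢p with x ≟ p | y ≟ p
... | no _    | no _    = refl
... | yes x≡p | _       = ⊥-elim (x≢p x≡p)
... | no _    | yes y≡p = ⊥-elim (y≢p y≡p)

copy-row : ∀ {r k} {p q : Fin r} (c : Fin r → Fin r → Fin k) {y} → y ≢ p → y ≢ q →
  copyᶜ p q c p y ≡ c q y
copy-row {p = p} {q} c {y} y≢p y≢q with p ≟ p | y ≟ p
... | no p≢p | _       = ⊥-elim (p≢p refl)
... | yes _  | yes y≡p = ⊥-elim (y≢p y≡p)
... | yes _  | no _    rewrite dec-false (y ≟ q) y≢q = refl

copy-edge : ∀ {r k} {p q : Fin r} (c : Fin r → Fin r → Fin k) → p ≢ q → copyᶜ p q c p q ≡ c p q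
copy-edge {p = p} {q} c p≢q with p ≟ p | q ≟ p
... | no p≢p | _       = ⊥-elim (p≢p refl)
... | yes _  | yes q≡p = ⊥-elim (p≢q (sym q≡p))
... | yes _  | no _    rewrite dec-true (q ≟ q) refl = refl

hue-symm : ∀ {r k} (c : Colouring r k) → ∀ i → Symm (hue (col c) i)
hue-symm (c , sy) i x y = cong (λ j → does (j ≟ i)) (sy x y)

-- On the left stand the old coefficients with the degree of `p` replaced by that of `q`. Copying
-- realises exactly this replacement, and the codegree does not fall by `twin-pairWeight`.
copy-gain : ∀ {r k} (c : Fin r → Fin r → Fin k) w g {p q R} → Unique (p ∷ q ∷ R) →
  total (hue c) w g R + (w p * degree (hue c) w g q R + w q * degree (hue c) w g q R)
    + w p * w q * codegree (hue c) w g p q R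
  ≤ total (hue (copyᶜ p q c)) w g (p ∷ q ∷ R)
copy-gain c w g {p} {q} {R} ((p≢q ∷ p≢R) ∷ q≢R ∷ _) = begin
  total a w g R + (w p * degree a w g q R + w q * degree a w g q R) + w p * w q * codegree a w g p q R
    ≡⟨ cong (_+ w p * w q * codegree a w g p q R) (cong₂ _+_ (∑-cong λ i → sym (cw-cong w (2 + g i) (agree i)))
         (cong₂ _+_ (cong (w p *_) (∑-cong λ i → sym (twin-cw (a i) (a′ i) w (1 + g i) p (agree i) (twinp i))))
                    (cong (w q *_) (∑-cong λ i → sym (twin-cw (a i) (a′ i) w (1 + g i) q (agree i) (twinq i)))))) ⟩
  total a′ w g R + (w p * degree a′ w g p R + w q * degree a′ w g q R) + w p * w q * codegree a w g p q R
    ≤⟨ +-monoʳ-≤ (total a′ w g R + _) (*-monoʳ-≤ (w p * w q) (∑-mono λ i →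
         twin-pairWeight w (g i) (hued i (copy-edge c p≢q)) (agree i) (twinp i) (twinq i))) ⟩
  total a′ w g R + (w p * degree a′ w g p R + w q * degree a′ w g q R) + w p * w q * codegree a′ w g p q R
    ≡⟨ total-∷∷ a′ w g p q R ⟨
  total a′ w g (p ∷ q ∷ R)  ∎
  where
  open ≤-Reasoning
  a = hue c
  a′ = hue (copyᶜ p q c)
  hued : ∀ i {x y} → x ≡ y → does (x ≟ i) ≡ does (y ≟ i)
  hued i = cong (λ j → does (j ≟ i))
  agree : ∀ i → AllPairs (λ x y → a′ i x y ≡ a i x y) R
  agree i = All⇒AllPairs (λ p≢x p≢y → hued i (copy-other c (p≢x ∘ sym) (p≢y ∘ sym))) p≢R
  twinp : ∀ i → All (λ y → a′ i p y ≡ a i q y) R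
  twinp i = All.zipWith (λ (p≢y , q≢y) → hued i (copy-row c (p≢y ∘ sym) (q≢y ∘ sym))) (p≢R , q≢R)
  twinq : ∀ i → All (λ y → a′ i q y ≡ a i q y) R
  twinq i = All.map (λ p≢y → hued i (copy-other c (p≢q ∘ sym) (p≢y ∘ sym))) p≢R

-- The two copies replace the degree of one vertex by that of the other and do not decrease the codegree.
copy-or-copy : ∀ {r k} (c : Colouring r k) {w : Fin r → ℕ} → (∀ x → 0 < w x) → ∀ g {p q} → p ≢ q →
  total (hue (col c)) w g (allFin r) ≤ total (hue (col (copy p q c))) w g (allFin r) ⊎
  total (hue (col c)) w g (allFin r) < total (hue (col (copy q p c))) w g (allFin r)
copy-or-copy {r} c {w} 0<w g {p} {q} p≢q
  with xs , all↭ ← ∈-↭ (∈-allFin p)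
  with ∈-resp-↭ all↭ (∈-allFin q)
... | here q≡p = ⊥-elim (p≢q (sym q≡p))
... | there q∈xs
  with R , xs↭ ← ∈-↭ q∈xs = compare
  where
  a = hue (col c)
  pq : allFin r ↭ p ∷ q ∷ R
  pq = Perm.trans all↭ (prep p xs↭)
  qp : allFin r ↭ q ∷ p ∷ R
  qp = Perm.trans pq (swap p q ↭-refl)
  S P Q D : ℕ
  S = total a w g R
  P = degree a w g p R
  Q = degree a w g q R
  D = codegree a w g p q R
  before : total a w g (allFin r) ≡ S + (w p * P + w q * Q) + w p * w q * D
  before = trans (total-↭ (hue-symm c) w g pq) (total-∷∷ a w g p q R)
  copy-pq : S + (w p * Q + w q * Q) + w p * w q * D ≤ total (hue (col (copy p q c))) w g (allFin r)
  copy-pq = ≤-trans (copy-gain (col c) w g (Unique-resp-↭ pq (allFin⁺ r)))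
                    (≤-reflexive (sym (total-↭ (hue-symm (copy p q c)) w g pq)))
  rearrange : ∀ u v S P D → S + (u * P + v * P) + u * v * D ≡ S + (v * P + u * P) + v * u * D
  rearrange = solve-∀
  copy-qp : S + (w p * P + w q * P) + w p * w q * D ≤ total (hue (col (copy q p c))) w g (allFin r)
  copy-qp = begin
    S + (w p * P + w q * P) + w p * w q * D  ≡⟨ rearrange (w p) (w q) S P D ⟩
    S + (w q * P + w p * P) + w q * w p * D
      ≡⟨ cong (λ d → S + (w q * P + w p * P) + w q * w p * d)
              (∑-cong λ i → pairWeight-sym (hue-symm c i) w (g i) p q R) ⟩
    S + (w q * P + w p * P) + w q * w p * codegree a w g q p R
      ≤⟨ copy-gain (col c) w g (Unique-resp-↭ qp (allFin⁺ r)) ⟩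
    total (hue (col (copy q p c))) w g (q ∷ p ∷ R)
      ≡⟨ total-↭ (hue-symm (copy q p c)) w g qp ⟨
    total (hue (col (copy q p c))) w g (allFin r)  ∎
    where open ≤-Reasoning
  compare : total a w g (allFin r) ≤ total (hue (col (copy p q c))) w g (allFin r) ⊎
            total a w g (allFin r) < total (hue (col (copy q p c))) w g (allFin r)
  compare rewrite before with ≤-<-connex P Q
  ... | inj₁ P≤Q = inj₁ (≤-trans
    (+-monoˡ-≤ _ (+-monoʳ-≤ S (+-monoˡ-≤ _ (*-monoʳ-≤ (w p) P≤Q)))) copy-pq)
  -- Here `q` is coloured like `p`; positivity of `w q` makes the gain strict.
  ... | inj₂ Q<P = inj₂ (<-≤-trans
    (+-monoˡ-< _ (+-monoʳ-< S (+-monoʳ-< _ (*-monoʳ-< (w q) {{>-nonZero (0<w q)}} Q<P)))) copy-qp)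

-- The first alternative abandons the current construction in favour of a strict improvement; the
-- second reaches `P` without loss.
Reach : {C : Set} → (C → ℕ) → (C → Set) → C → Set
Reach f P c = (∃ λ c′ → f c < f c′) ⊎ (∃ λ c′ → f c ≤ f c′ × P c′)

bind : {C : Set} {f : C → ℕ} {P Q : C → Set} → ∀ {c} → Reach f P c → (∀ {c′} → P c′ → Reach f Q c′) → Reach f Q c
bind (inj₁ gain)            k = inj₁ gain
bind (inj₂ (c′ , le , Pc′)) k with k Pc′
... | inj₁ (d , lt)      = inj₁ (d , ≤-<-trans le lt)
... | inj₂ (d , le′ , Q) = inj₂ (d , ≤-trans le le′ , Q)

-- A strict gain restarts the search, and the bound on f lets this happen only finitely often.
reach-bounded : {C : Set} {f : C → ℕ} {P : C → Set} {b : ℕ} → (∀ c → f c ≤ b) → (∀ c → Reach f P c) →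
  ∀ c → ∃ λ c′ → f c ≤ f c′ × P c′
reach-bounded {C} {f} {P} {b} f≤b reach c = go b c (m≤n+m b (f c))
  where
  go : ∀ n c → b ≤ f c + n → ∃ λ c′ → f c ≤ f c′ × P c′
  go n c b≤ with reach c
  go n       c b≤ | inj₂ found     = found
  go zero    c b≤ | inj₁ (c′ , lt) =
    ⊥-elim (<⇒≱ lt (≤-trans (f≤b c′) (≤-trans b≤ (≤-reflexive (+-identityʳ (f c))))))
  go (suc n) c b≤ | inj₁ (c′ , lt)
    with d , le , Pd ← go n c′ (≤-trans b≤ (≤-trans (≤-reflexive (+-suc (f c) n)) (+-monoˡ-≤ n lt)))
    = d , ≤-trans (<⇒≤ lt) le , Pd

Mono : ∀ {r k} → Fin k → Colouring r k → Set
Mono i c = ∀ {x y} → x ≢ y → col c x y ≡ i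

-- Either the copy in the desired direction loses nothing, or the opposite one gains strictly and
-- restarts the search. The asymmetry lets a construction choose the direction of every copy.
Copying : ∀ {r k} → (Colouring r k → ℕ) → Set
Copying f = ∀ c {p q} → p ≢ q → f c ≤ f (copy p q c) ⊎ f c < f (copy q p c)

do-copy : ∀ {r k} {f : Colouring r k → ℕ} {P : Colouring r k → Set} → Copying f → ∀ c {p q} → p ≢ q →
  P (copy p q c) → Reach f P c
do-copy copying c p≢q Pc with copying c p≢q
... | inj₁ le = inj₂ (_ , le , Pc)
... | inj₂ lt = inj₁ (_ , lt)

-- Colouring `p` like `q` gives the edge from `p` to `x` the colour of the edge from `q` to `x` and
-- changes only edges at `p`, so the vertices of `ps` can be treated one after another.
reach-star : ∀ {r k} {f : Colouring r k → ℕ} → Copying f → ∀ {q x} → q ≢ x → ∀ ps c →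
  Reach f (λ c′ → ∀ {p} → p ∈ ps → p ≢ x → col c′ p x ≡ col c′ q x) c
reach-star copying q≢x []       c = inj₂ (c , ≤-refl , λ ())
reach-star {r} {k} {f} copying {q} {x} q≢x (p ∷ ps) c = bind (reach-star copying q≢x ps c) extend
  where
  extend : ∀ {c} → (∀ {p} → p ∈ ps → p ≢ x → col c p x ≡ col c q x) →
    Reach f (λ c′ → ∀ {p′} → p′ ∈ p ∷ ps → p′ ≢ x → col c′ p′ x ≡ col c′ q x) c
  extend {c} star with p ≟ x | p ≟ q
  ... | yes p≡x | _        = inj₂ (c , ≤-refl , λ
    { (here p′≡p) p′≢x → ⊥-elim (p′≢x (trans p′≡p p≡x)) ; (there p′∈ps) → star p′∈ps })
  ... | no _    | yes refl = inj₂ (c , ≤-refl , λ { (here refl) _ → refl ; (there p′∈ps) → star p′∈ps })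
  ... | no p≢x  | no p≢q   = do-copy copying c p≢q λ {p′} → star′ {p′}
    where
    row : col (copy p q c) p x ≡ col (copy p q c) q x
    row = trans (copy-row (col c) (p≢x ∘ sym) (q≢x ∘ sym)) (sym (copy-other (col c) (p≢q ∘ sym) (p≢x ∘ sym)))
    star′ : ∀ {p′} → p′ ∈ p ∷ ps → p′ ≢ x → col (copy p q c) p′ x ≡ col (copy p q c) q x
    star′ (here refl) _ = row
    star′ {p′} (there p′∈ps) p′≢x = case p′ ≟ p of λ where
      (yes refl) → row
      (no p′≢p)  → trans (copy-other (col c) p′≢p (p≢x ∘ sym))
                     (trans (star p′∈ps p′≢x) (sym (copy-other (col c) (p≢q ∘ sym) (p≢x ∘ sym))))

Star : ∀ {r k} → Fin k → Fin r → Colouring r k → Set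
Star i x c = ∀ {p} → p ≢ x → col c p x ≡ i

-- Colouring `y` like the centre `x` turns all edges at `y` into colour `i`: those to other vertices
-- take the colour of the star, and the edge to `x` had it already. Rows finished earlier change
-- only at `y`, again to `i`.
reach-rows : ∀ {r k} {f : Colouring r k → ℕ} → Copying f → ∀ {i x} ys c → Star i x c →
  Reach f (λ c′ → Star i x c′ × (∀ {y z} → y ∈ ys → z ≢ y → col c′ y z ≡ i)) c
reach-rows copying []       c star = inj₂ (c , ≤-refl , star , λ ())
reach-rows {r} {k} {f} copying {i} {x} (y ∷ ys) c star = bind (reach-rows copying ys c star) λ {c} → extend {c}
  where
  extend : ∀ {c} → Star i x c × (∀ {y z} → y ∈ ys → z ≢ y → col c y z ≡ i) →
    Reach f (λ c′ → Star i x c′ × (∀ {y′ z} → y′ ∈ y ∷ ys → z ≢ y′ → col c′ y′ z ≡ i)) c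
  extend {c} (star , rows) with y ≟ x
  ... | yes refl = inj₂ (c , ≤-refl , star , λ
    { {_} {z} (here refl) z≢x → trans (proj₂ c x z) (star z≢x) ; (there y′∈ys) → rows y′∈ys })
  ... | no y≢x   = do-copy copying c y≢x ((λ {p} → star′ {p}) , λ {y′} {z} → rows′ {y′} {z})
    where
    row : ∀ {z} → z ≢ y → col (copy y x c) y z ≡ i
    row {z} z≢y = case z ≟ x of λ where
      (yes refl) → trans (copy-edge (col c) y≢x) (star y≢x)
      (no z≢x)   → trans (copy-row (col c) z≢y z≢x) (trans (proj₂ c x z) (star z≢x))
    star′ : Star i x (copy y x c)
    star′ {p} p≢x = case p ≟ y of λ where
      (yes refl) → row (y≢x ∘ sym)
      (no p≢y)   → trans (copy-other (col c) p≢y (y≢x ∘ sym)) (star p≢x)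
    rows′ : ∀ {y′ z} → y′ ∈ y ∷ ys → z ≢ y′ → col (copy y x c) y′ z ≡ i
    rows′ (here refl) z≢y = row z≢y
    rows′ {y′} {z} (there y′∈ys) z≢y′ = case ((y′ ≟ y) , (z ≟ y)) of λ where
      (yes refl , _)        → row z≢y′
      (no y′≢y  , yes refl) → trans (proj₂ (copy y x c) y′ y) (row y′≢y)
      (no y′≢y  , no z≢y)   → trans (copy-other (col c) y′≢y z≢y) (rows y′∈ys z≢y′)

-- With at most one vertex any colour serves. Otherwise the edges at `suc zero` are first matched to
-- its edge from `zero`, whose colour then spreads to all rows.
reach-mono : ∀ {r k} {f : Colouring r k → ℕ} → Copying f → Fin k → ∀ c → Reach f (λ c′ → ∃ λ i → Mono i c′) c
reach-mono {zero}        copying i c = inj₂ (c , ≤-refl , i , λ { {()} })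
reach-mono {suc zero}    copying i c = inj₂ (c , ≤-refl , i , λ { {zero} {zero} 0≢0 → ⊥-elim (0≢0 refl) })
reach-mono {suc (suc r)} copying _ c =
  bind (reach-star copying {zero} {suc zero} (λ ()) (allFin _) c) λ {c} star →
  bind (reach-rows copying (allFin _) c (λ {p} → star (∈-allFin p))) λ {c} (_ , rows) →
  inj₂ (c , ≤-refl , _ , λ {x} {y} x≢y → rows (∈-allFin x) (x≢y ∘ sym))

-- A colour other than `i` has no edges, hence no cliques of size at least two; colour `i` is
-- bounded by `e`.
total-mono : ∀ {r k} {i : Fin k} (c : Colouring r k) → Mono i c → ∀ w g →
  total (hue (col c)) w g (allFin r) ≤ e (2 + g i) (map w (allFin r))
total-mono {r} {i = i} c mono w g = ≤-trans
  (≤-reflexive (∑-single i λ j j≢i → cw-edgeless w (g j)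
    (AllPairs.map (λ x≢y → dec-false (_ ≟ j) λ cxy≡j → j≢i (trans (sym cxy≡j) (mono x≢y))) (allFin⁺ r))))
  (cw≤e (hue (col c) i) w (2 + g i) (allFin r))

total≤e : ∀ {r k} → Fin k → (c : Colouring r k) {w : Fin r → ℕ} → (∀ x → 0 < w x) → ∀ g →
  ∃ λ i → total (hue (col c)) w g (allFin r) ≤ e (2 + g i) (map w (allFin r))
total≤e {r} i₀ c {w} 0<w g
  with c′ , le , i , mono ← reach-bounded
         (λ c → ∑-mono λ i → cw≤e (hue (col c) i) w (2 + g i) (allFin r))
         (reach-mono {f = λ c → total (hue (col c)) w g (allFin r)} (λ c p≢q → copy-or-copy c 0<w g p≢q) i₀) c
  = i , ≤-trans le (total-mono c′ mono w g)

-- Balancing the weights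

-- Reads `e` as a clique count with all pairs adjacent and borrows its permutation invariance.
e-↭ : ∀ h {ws ws′} → ws ↭ ws′ → e h ws ≡ e h ws′
e-↭ h {ws} {ws′} ws↭ = begin
  e h ws                       ≡⟨ as-cw ws ⟩
  cw (λ _ _ → true) id h ws    ≡⟨ cw-↭ (λ _ _ → refl) id h ws↭ ⟩
  cw (λ _ _ → true) id h ws′   ≡⟨ as-cw ws′ ⟨
  e h ws′                      ∎
  where
  open ≡-Reasoning
  always : ∀ (ws : List ℕ) → AllPairs (λ _ _ → T true) ws
  always []       = []
  always (_ ∷ ws) = All.universal _ ws ∷ always ws
  as-cw : ∀ ws → e h ws ≡ cw (λ _ _ → true) id h ws
  as-cw ws = trans (cong (e h) (sym (map-id ws))) (sym (cw-complete id h (always ws)))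

e-0∷ : ∀ h ws → e h (0 ∷ ws) ≡ e h ws
e-0∷ zero    ws = refl
e-0∷ (suc h) ws = refl

e-0++ : ∀ h m ws → e h (replicate m 0 ++ ws) ≡ e h ws
e-0++ h zero    ws = refl
e-0++ h (suc m) ws = trans (e-0∷ h (replicate m 0 ++ ws)) (e-0++ h m ws)

-- In its first two entries `e` has the form `u * v * X + (u + v) * Y + Z`, so for a fixed sum it is
-- monotone in the product.
e-pair : ∀ h {u v u′ v′} R → u + v ≡ u′ + v′ → u * v ≤ u′ * v′ → e h (u ∷ v ∷ R) ≤ e h (u′ ∷ v′ ∷ R)
e-pair zero          R eq le = ≤-refl
e-pair (suc zero) {u} {v} {u′} {v′} R eq le = ≤-reflexive (begin
  u * 1 + (v * 1 + e 1 R)    ≡⟨ rearrange u v (e 1 R) ⟩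
  u + v + e 1 R              ≡⟨ cong (_+ e 1 R) eq ⟩
  u′ + v′ + e 1 R            ≡⟨ rearrange u′ v′ (e 1 R) ⟨
  u′ * 1 + (v′ * 1 + e 1 R)  ∎)
  where
  open ≡-Reasoning
  rearrange : ∀ u v z → u * 1 + (v * 1 + z) ≡ u + v + z
  rearrange = solve-∀
e-pair (suc (suc h)) {u} {v} {u′} {v′} R eq le = begin
  u * (v * X + Y) + (v * Y + Z)      ≡⟨ rearrange u v X Y Z ⟩
  u * v * X + ((u + v) * Y + Z)      ≡⟨ cong (λ s → u * v * X + (s * Y + Z)) eq ⟩
  u * v * X + ((u′ + v′) * Y + Z)    ≤⟨ +-monoˡ-≤ _ (*-monoˡ-≤ X le) ⟩
  u′ * v′ * X + ((u′ + v′) * Y + Z)  ≡⟨ rearrange u′ v′ X Y Z ⟨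
  u′ * (v′ * X + Y) + (v′ * Y + Z)   ∎
  where
  open ≤-Reasoning
  X Y Z : ℕ
  X = e h R
  Y = e (1 + h) R
  Z = e (2 + h) R
  rearrange : ∀ u v X Y Z → u * (v * X + Y) + (v * Y + Z) ≡ u * v * X + ((u + v) * Y + Z)
  rearrange = solve-∀

sum-≤ : {B : Set} {f g : B → ℕ} → ∀ {xs} → All (λ x → f x ≤ g x) xs → sum (map f xs) ≤ sum (map g xs)
sum-≤ []         = z≤n
sum-≤ (le ∷ les) = +-mono-≤ le (sum-≤ les)

≤∧sum≡⇒≡ : {B : Set} {f g : B → ℕ} → ∀ {xs} → All (λ x → f x ≤ g x) xs →
  sum (map f xs) ≡ sum (map g xs) → map f xs ≡ map g xs
≤∧sum≡⇒≡ []                            eq = refl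
≤∧sum≡⇒≡ {f = f} {g} {x ∷ xs} (le ∷ les) eq =
  cong₂ _∷_ fx≡gx (≤∧sum≡⇒≡ les (+-cancelˡ-≡ (f x) _ _ (trans eq (cong (_+ sum (map g xs)) (sym fx≡gx)))))
  where
  fx≡gx : f x ≡ g x
  fx≡gx = ≤-antisym le (+-cancelʳ-≤ (sum (map f xs)) _ _
    (≤-trans (+-monoʳ-≤ (g x) (sum-≤ les)) (≤-reflexive (sym eq))))

-- The targets proj₂ differ by at most one, so an entry above its target exceeds every entry below its own,
-- and moving a unit from the former to the latter does not decrease e.
balance : ∀ h s (ps : List (ℕ × ℕ)) → All (λ x → s ≤ proj₂ x × proj₂ x ≤ suc s) ps →
  sum (map proj₁ ps) ≡ sum (map proj₂ ps) → e h (map proj₁ ps) ≤ e h (map proj₂ ps)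
balance h s ps near eq = go _ ps refl near eq
  where
  excess : List (ℕ × ℕ) → ℕ
  excess ps = sum (map (λ x → proj₁ x ∸ proj₂ x) ps)

  go : ∀ n ps → excess ps ≡ n → All (λ x → s ≤ proj₂ x × proj₂ x ≤ suc s) ps →
    sum (map proj₁ ps) ≡ sum (map proj₂ ps) → e h (map proj₁ ps) ≤ e h (map proj₂ ps)

  move : ∀ n {w₁ t₁ w₂ t₂} R → t₁ < w₁ → w₂ < t₂ → let ps = (w₁ , t₁) ∷ (w₂ , t₂) ∷ R in
    excess ps ≡ n → All (λ x → s ≤ proj₂ x × proj₂ x ≤ suc s) ps →
    sum (map proj₁ ps) ≡ sum (map proj₂ ps) → e h (map proj₁ ps) ≤ e h (map proj₂ ps)
  move n {suc w₁} {t₁} {w₂} {t₂} R (s≤s t₁≤w₁) w₂<t₂ ex ((s≤t₁ , t₁≤1+s) ∷ (s≤t₂ , t₂≤1+s) ∷ near) eq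
    rewrite +-∸-assoc 1 t₁≤w₁ | m≤n⇒m∸n≡0 (<⇒≤ w₂<t₂) with n
  ... | suc n = ≤-trans
    (e-pair h (map proj₁ R) (sym (+-suc w₁ w₂)) product≤)
    -- The first entry loses one unit of excess and the second stays at or below its target, so the
    -- recursion descends.
    (go n ((w₁ , t₁) ∷ (suc w₂ , t₂) ∷ R)
        (trans (cong (λ z → w₁ ∸ t₁ + (z + excess R)) (m≤n⇒m∸n≡0 w₂<t₂)) (suc-injective ex))
        ((s≤t₁ , t₁≤1+s) ∷ (s≤t₂ , t₂≤1+s) ∷ near) (trans (rearrange w₁ w₂ _) eq))
    where
    rearrange : ∀ u v z → u + (suc v + z) ≡ suc u + (v + z)
    rearrange = solve-∀
    product≤ : suc w₁ * w₂ ≤ w₁ * suc w₂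
    product≤ = begin
      -- `w₂ < t₂ ≤ 1 + s` and `s ≤ t₁ ≤ w₁` give `w₂ ≤ w₁`, which is what the product inequality
      -- amounts to.
      w₂ + w₁ * w₂    ≤⟨ +-monoˡ-≤ (w₁ * w₂) (≤-trans (≤-pred (≤-trans w₂<t₂ t₂≤1+s)) (≤-trans s≤t₁ t₁≤w₁)) ⟩
      w₁ + w₁ * w₂    ≡⟨ expand w₁ w₂ ⟨
      w₁ * suc w₂     ∎
      where
      open ≤-Reasoning
      expand : ∀ u v → u * suc v ≡ u + u * v
      expand = solve-∀

  go n ps ex near eq with all? (λ x → proj₁ x ≤? proj₂ x) ps | all? (λ x → proj₂ x ≤? proj₁ x) ps
  -- With equal sums, if no entry exceeds its target, none can lie below it.
  ... | yes w≤t | _       = ≤-reflexive (cong (e h) (≤∧sum≡⇒≡ w≤t eq))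
  ... | no _    | yes t≤w = ≤-reflexive (cong (e h) (sym (≤∧sum≡⇒≡ t≤w (sym eq))))
  ... | no w≰t  | no t≰w
    with (w₁ , t₁) , ∈₁ , w₁≰t₁ ← find (All.¬All⇒Any¬ (λ x → proj₁ x ≤? proj₂ x) ps w≰t)
       | (w₂ , t₂) , ∈₂ , t₂≰w₂ ← find (All.¬All⇒Any¬ (λ x → proj₂ x ≤? proj₁ x) ps t≰w)
    with qs , ps↭ ← ∈-↭ ∈₁
    with ∈-resp-↭ ps↭ ∈₂
  ... | here refl = ⊥-elim (w₁≰t₁ (<⇒≤ (≰⇒> t₂≰w₂)))
  ... | there ∈qs with R , qs↭ ← ∈-↭ ∈qs = begin
    e h (map proj₁ ps)  ≡⟨ e-↭ h (map⁺ proj₁ ps↭₂) ⟩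
    e h (map proj₁ rs)
      ≤⟨ move n R (≰⇒> w₁≰t₁) (≰⇒> t₂≰w₂) (trans (sym (sum-↭ (map⁺ (λ x → proj₁ x ∸ proj₂ x) ps↭₂))) ex)
           (All-resp-↭ ps↭₂ near) (trans (sym (sum-↭ (map⁺ proj₁ ps↭₂))) (trans eq (sum-↭ (map⁺ proj₂ ps↭₂)))) ⟩
    e h (map proj₂ rs)  ≡⟨ e-↭ h (map⁺ proj₂ ps↭₂) ⟨
    e h (map proj₂ ps)  ∎
    where
    open ≤-Reasoning
    rs = (w₁ , t₁) ∷ (w₂ , t₂) ∷ R
    ps↭₂ : ps ↭ rs
    ps↭₂ = ↭-trans ps↭ (prep _ qs↭)

unzip-≡ : {B C : Set} (xs : List B) (ys : List C) → length xs ≡ length ys →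
  ∃ λ (ps : List (B × C)) → map proj₁ ps ≡ xs × map proj₂ ps ≡ ys
unzip-≡ []       []       _  = [] , refl , refl
unzip-≡ (x ∷ xs) (y ∷ ys) eq with ps , refl , refl ← unzip-≡ xs ys (suc-injective eq) = (x , y) ∷ ps , refl , refl

-- Zeros change neither the sum nor `e`, so `ws` can be padded to the length of `ts` and paired
-- entry by entry with its targets.
e-≤-balanced : ∀ h s ws ts → length ws ≤ length ts → sum ws ≡ sum ts → All (λ t → s ≤ t × t ≤ suc s) ts →
  e h ws ≤ e h ts
e-≤-balanced h s ws ts len eq near
  with ps , ps₁ , refl ← unzip-≡ (replicate (length ts ∸ length ws) 0 ++ ws) ts
         (trans (length-++ (replicate (length ts ∸ length ws) 0))
           (trans (cong (_+ length ws) (length-replicate (length ts ∸ length ws))) (m∸n+n≡m len)))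
  = begin
  e h ws                         ≡⟨ e-0++ h d ws ⟨
  e h (replicate d 0 ++ ws)      ≡⟨ cong (e h) ps₁ ⟨
  e h (map proj₁ ps)             ≤⟨ balance h s ps (All.map⁻ near) (trans (cong sum ps₁) (trans (sum-0++ d) eq)) ⟩
  e h (map proj₂ ps)             ∎
  where
  open ≤-Reasoning
  d = length ts ∸ length ws
  sum-0++ : ∀ d → sum (replicate d 0 ++ ws) ≡ sum ws
  sum-0++ zero    = refl
  sum-0++ (suc d) = sum-0++ d

-- Clique counts of complete multipartite graphs.

count : ∀ {r} {B : Set} → (B → Fin r) → List B → Fin r → ℕ
count π xs j = length (filter (λ x → π x ≟ j) xs)

sizes : ∀ {r} {B : Set} → (B → Fin r) → List B → List ℕ
sizes {r} π xs = map (count π xs) (allFin r)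

diffPart : ∀ {r} {B : Set} → (B → Fin r) → B → B → Bool
diffPart π x y = not (does (π x ≟ π y))

count-nbrs-own : ∀ {r} {B : Set} (π : B → Fin r) x xs → count π (nbrs (diffPart π) x xs) (π x) ≡ 0
count-nbrs-own π x []       = refl
count-nbrs-own π x (y ∷ xs) with π x ≟ π y
... | yes _     = count-nbrs-own π x xs
... | no πx≢πy rewrite dec-false (π y ≟ π x) (πx≢πy ∘ sym) = count-nbrs-own π x xs

count-nbrs-other : ∀ {r} {B : Set} (π : B → Fin r) x xs {j} → π x ≢ j →
  count π (nbrs (diffPart π) x xs) j ≡ count π xs j
count-nbrs-other π x []       πx≢j = refl
count-nbrs-other π x (y ∷ xs) {j} πx≢j with π x ≟ π y
... | yes πx≡πy rewrite dec-false (π y ≟ j) (πx≢j ∘ trans πx≡πy) = count-nbrs-other π x xs πx≢j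
... | no _ with does (π y ≟ j)
...   | true  = cong suc (count-nbrs-other π x xs πx≢j)
...   | false = count-nbrs-other π x xs πx≢j

-- `c` is the size of the part of `x` in `xs`, and `M` lists the other sizes: adding `x` raises only
-- its own part, and passing to the neighbours of `x` empties only that part.
sizes-∷ : ∀ {r} {B : Set} (π : B → Fin r) x xs → ∃₂ λ c M →
  sizes π (x ∷ xs) ↭ suc c ∷ M × sizes π xs ↭ c ∷ M × sizes π (nbrs (diffPart π) x xs) ↭ 0 ∷ M
sizes-∷ {r} π x xs with js , all↭ ← ∈-↭ (∈-allFin (π x))
  with j∉js ∷ _ ← Unique-resp-↭ all↭ (allFin⁺ r)
  = count π xs (π x) , map (count π xs) js
  , ↭-trans (map⁺ _ all↭) (↭-reflexive (cong₂ _∷_ (cong length (filter-accept (λ y → π y ≟ π x) refl))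
      (agree (λ {j} j≢ → cong length (filter-reject (λ y → π y ≟ j) j≢)) j∉js)))
  , map⁺ _ all↭
  , ↭-trans (map⁺ _ all↭) (↭-reflexive (cong₂ _∷_ (count-nbrs-own π x xs)
      (agree (count-nbrs-other π x xs) j∉js)))
  where
  agree : ∀ {f g : Fin r → ℕ} {j js} → (∀ {j′} → j ≢ j′ → f j′ ≡ g j′) → All (j ≢_) js → map f js ≡ map g js
  agree f≡g []         = refl
  agree f≡g (j≢ ∷ j≢s) = cong₂ _∷_ (f≡g j≢) (agree f≡g j≢s)

-- Linearity of `e` in the size of the part of `x`: the extra unit contributes `e h` of the other
-- sizes, which are the sizes among the neighbours of `x` up to a zero.
e-sizes-∷ : ∀ {r} {B : Set} (π : B → Fin r) h x xs →
  e (suc h) (sizes π (x ∷ xs)) ≡ 1 * e h (sizes π (nbrs (diffPart π) x xs)) + e (suc h) (sizes π xs)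
e-sizes-∷ π h x xs with c , M , ↭suc , ↭c , ↭0 ← sizes-∷ π x xs = begin
  e (suc h) (sizes π (x ∷ xs))                ≡⟨ e-↭ (suc h) ↭suc ⟩
  suc c * e h M + e (suc h) M                 ≡⟨ rearrange c (e h M) (e (suc h) M) ⟩
  1 * e h M + e (suc h) (c ∷ M)
    ≡⟨ cong₂ (λ m n → 1 * m + n) (trans (e-↭ h ↭0) (e-0∷ h M)) (e-↭ (suc h) ↭c) ⟨
  1 * e h (sizes π (nbrs (diffPart π) x xs)) + e (suc h) (sizes π xs)  ∎
  where
  open ≡-Reasoning
  rearrange : ∀ c X Y → suc c * X + Y ≡ 1 * X + (c * X + Y)
  rearrange = solve-∀

-- A clique takes at most one vertex from each part; in the induction both sides satisfy the same
-- recursion on the list.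
cw-diffPart : ∀ {r} {B : Set} (π : B → Fin r) h xs → cw (diffPart π) (const 1) h xs ≡ e h (sizes π xs)
cw-diffPart π zero    xs       = refl
cw-diffPart {r} π (suc h) [] = sym (e-zeros (allFin r))
  where
  e-zeros : ∀ js → e (suc h) (map (count π []) js) ≡ 0
  e-zeros []       = refl
  e-zeros (j ∷ js) = e-zeros js
cw-diffPart π (suc h) (x ∷ xs) = trans
  (cong₂ (λ m n → 1 * m + n) (cw-diffPart π h (nbrs (diffPart π) x xs)) (cw-diffPart π (suc h) xs))
  (sym (e-sizes-∷ π h x xs))

sum-sizes : ∀ {r} {B : Set} (π : B → Fin r) xs → sum (sizes π xs) ≡ length xs
sum-sizes {r} π [] = sum-zeros (allFin r)
  where
  sum-zeros : ∀ js → sum (map (count π []) js) ≡ 0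
  sum-zeros []       = refl
  sum-zeros (j ∷ js) = sum-zeros js
sum-sizes π (x ∷ xs) with c , M , ↭suc , ↭c , _ ← sizes-∷ π x xs =
  trans (sum-↭ ↭suc) (cong suc (trans (sym (sum-↭ ↭c)) (sum-sizes π xs)))

⌈/⌉≤1+⌊/⌋ : ∀ n r .{{_ : NonZero r}} → ⌈ n / r ⌉ ≤ suc ⌊ n / r ⌋
⌈/⌉≤1+⌊/⌋ n r = begin
  (n + (r ∸ 1)) / r  ≤⟨ /-monoˡ-≤ r (+-monoʳ-≤ n (m∸n≤m r 1)) ⟩
  (n + r) / r        ≡⟨ +-distrib-/-∣ʳ n ∣-refl ⟩
  n / r + r / r      ≡⟨ cong (n / r +_) (n/n≡1 r) ⟩
  n / r + 1          ≡⟨ +-comm (n / r) 1 ⟩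
  suc (n / r)        ∎
  where open ≤-Reasoning

adj-Turán : ∀ r .{{_ : NonZero r}} {n} {T : Graph n} (tur : IsTurán r T) → ∀ u v →
  adj T u v ≡ diffPart (IsTurán.part tur) u v
adj-Turán r {T = T} tur u v with adj T u v | IsTurán.part tur u ≟ IsTurán.part tur v | IsTurán.adj⇔ tur u v
... | true  | yes eq | (⇒ , _) = ⊥-elim (⇒ _ eq)
... | true  | no _   | _       = refl
... | false | yes _  | _       = refl
... | false | no neq | (_ , ⇐) = ⊥-elim (⇐ neq)

-- The part sizes of a Turán graph sum to `n` and lie between `⌊ n / r ⌋` and one more, so they
-- serve as balanced targets for `ws`.
e≤cw-Turán : ∀ r .{{_ : NonZero r}} {n} {T : Graph n} → IsTurán r T → ∀ h ws → length ws ≤ r → sum ws ≡ n →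
  e h ws ≤ cw (adj T) (const 1) h (allFin n)
e≤cw-Turán r {n} {T} tur h ws len mass = begin
  e h ws
    ≤⟨ e-≤-balanced h ⌊ n / r ⌋ ws (sizes part (allFin n))
         (≤-trans len (≤-reflexive (sym (trans (length-map _ (allFin r)) (length-tabulate id)))))
         (trans mass (sym (trans (sum-sizes part (allFin n)) (length-tabulate id))))
         (All.map⁺ (All.universal near (allFin r))) ⟩
  e h (sizes part (allFin n))               ≡⟨ cw-diffPart part h (allFin n) ⟨
  cw (diffPart part) (const 1) h (allFin n) ≡⟨ cw-cong (const 1) h (AllPairs.map (λ _ → adj-Turán r tur _ _) (allFin⁺ n)) ⟨
  cw (adj T) (const 1) h (allFin n)         ∎
  where
  open ≤-Reasoning
  open IsTurán tur
  near : ∀ j → ⌊ n / r ⌋ ≤ partSize part j × partSize part j ≤ suc ⌊ n / r ⌋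
  near j with partSize part j | balanced j
  ... | _ | inj₁ refl = ≤-refl , n≤1+n _
  ... | _ | inj₂ refl = /-monoˡ-≤ r (m≤m+n n (r ∸ 1)) , ⌈/⌉≤1+⌊/⌋ n r

-- Copies of complete graphs

T⇒≡true : ∀ {b} → T b → b ≡ true
T⇒≡true {true} _ = refl

≡true⇒T : ∀ {b} → b ≡ true → T b
≡true⇒T refl = _

¬T⇒≡false : ∀ {b} → ¬ T b → b ≡ false
¬T⇒≡false {true}  ¬b = ⊥-elim (¬b _)
¬T⇒≡false {false} _  = refl

T-ext : ∀ {b c} → (T b → T c) → (T c → T b) → b ≡ c
T-ext {true}  {true}  _ _ = refl
T-ext {true}  {false} f _ = ⊥-elim (f _)
T-ext {false} {true}  _ g = ⊥-elim (g _)
T-ext {false} {false} _ _ = refl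

T-does⁻ : {P : Set} (P? : Dec P) → T (does P?) → P
T-does⁻ (yes p) _ = p

T-does⁺ : {P : Set} (P? : Dec P) → P → T (does P?)
T-does⁺ P? p = ≡true⇒T (dec-true P? p)

AllPairs-lookup : {B : Set} {R : B → B → Set} → (∀ {x y} → R x y → R y x) → ∀ {xs} → AllPairs R xs →
  ∀ {i j} → i ≢ j → R (lookup xs i) (lookup xs j)
AllPairs-lookup sy (Rx ∷ Rxs) {zero}  {zero}  i≢j = ⊥-elim (i≢j refl)
AllPairs-lookup sy (Rx ∷ Rxs) {zero}  {suc j} i≢j = All.lookup Rx (∈-lookup j)
AllPairs-lookup sy (Rx ∷ Rxs) {suc i} {zero}  i≢j = sy (All.lookup Rx (∈-lookup i))
AllPairs-lookup sy (Rx ∷ Rxs) {suc i} {suc j} i≢j = AllPairs-lookup sy Rxs (i≢j ∘ cong suc)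

AllPairs-∈ : {B : Set} {R : B → B → Set} → (∀ {x y} → R x y → R y x) → ∀ {xs} → AllPairs R xs →
  ∀ {x y} → x ∈ xs → y ∈ xs → x ≢ y → R x y
AllPairs-∈ {R = R} sy {xs} Rxs x∈ y∈ x≢y = subst₂ R (sym (lookup-index x∈)) (sym (lookup-index y∈))
  (AllPairs-lookup sy Rxs λ i≡j → x≢y (trans (lookup-index x∈) (trans (cong (lookup xs) i≡j) (sym (lookup-index y∈)))))

unique-⊆-length : {B : Set} {xs ys : List B} → Unique xs → (∀ {x} → x ∈ xs → x ∈ ys) → length xs ≤ length ys
unique-⊆-length {xs = []}     _           _  = z≤n
unique-⊆-length {xs = x ∷ xs} u@(_ ∷ xs!) ⊆ys with zs , ys↭ ← ∈-↭ (⊆ys (here refl)) =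
  ≤-trans (s≤s (unique-⊆-length xs! λ y∈xs → drop-x y∈xs (∈-resp-↭ ys↭ (⊆ys (there y∈xs)))))
          (≤-reflexive (sym (↭-length ys↭)))
  where
  drop-x : ∀ {y} → y ∈ xs → y ∈ x ∷ zs → y ∈ zs
  drop-x y∈xs (here refl)  = ⊥-elim (Unique[x∷xs]⇒x∉xs u y∈xs)
  drop-x y∈xs (there y∈zs) = y∈zs

unique-length : {B : Set} {xs ys : List B} → Unique xs → Unique ys → (∀ {x} → x ∈ xs → x ∈ ys) →
  (∀ {x} → x ∈ ys → x ∈ xs) → length xs ≡ length ys
unique-length xs! ys! ⊆ ⊇ = ≤-antisym (unique-⊆-length xs! ⊆) (unique-⊆-length ys! ⊇)

cliques : {B : Set} → (B → B → Bool) → ℕ → List B → List (List B)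
cliques a zero    xs       = [] ∷ []
cliques a (suc h) []       = []
cliques a (suc h) (x ∷ xs) = map (x ∷_) (cliques a h (nbrs a x xs)) ++ cliques a (suc h) xs

length-cliques : {B : Set} (a : B → B → Bool) → ∀ h xs → length (cliques a h xs) ≡ cw a (const 1) h xs
length-cliques a zero    xs       = refl
length-cliques a (suc h) []       = refl
length-cliques a (suc h) (x ∷ xs) = trans (length-++ (map (x ∷_) (cliques a h (nbrs a x xs))))
  (cong₂ _+_ (trans (length-map (x ∷_) (cliques a h (nbrs a x xs)))
                    (trans (length-cliques a h (nbrs a x xs)) (sym (+-identityʳ _))))
             (length-cliques a (suc h) xs))

record IsClique {B : Set} (a : B → B → Bool) (h : ℕ) (xs l : List B) : Set where
  constructor isClique
  field
    sublist  : l ⊆ xs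
    adjacent : AllPairs (λ x y → T (a x y)) l
    size     : length l ≡ h

∈-cliques⁻ : {B : Set} (a : B → B → Bool) → ∀ h xs {l} → l ∈ cliques a h xs → IsClique a h xs l
∈-cliques⁻ a zero    xs       (here refl) = isClique (minimum xs) [] refl
∈-cliques⁻ a (suc h) (x ∷ xs) l∈ with ∈-++⁻ (map (x ∷_) (cliques a h (nbrs a x xs))) l∈
... | inj₂ l∈xs with isClique l⊆ adj size ← ∈-cliques⁻ a (suc h) xs l∈xs = isClique (x ∷ʳ l⊆) adj size
... | inj₁ l∈map with l , l∈nbrs , refl ← ∈-map⁻ (x ∷_) l∈map
                 with isClique l⊆ adj size ← ∈-cliques⁻ a h (nbrs a x xs) l∈nbrs =
  isClique (refl ∷ ⊆-trans l⊆ (filter-⊆ (T? ∘ a x) xs))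
           (All-resp-⊆ l⊆ (All.all-filter (T? ∘ a x) xs) ∷ adj) (cong suc size)

⊆-filterᵇ : {B : Set} (p : B → Bool) → ∀ {l xs} → l ⊆ xs → All (T ∘ p) l → l ⊆ filterᵇ p xs
⊆-filterᵇ p []            []        = []
⊆-filterᵇ p (y ∷ʳ l⊆)     pl with p y
... | true  = y ∷ʳ ⊆-filterᵇ p l⊆ pl
... | false = ⊆-filterᵇ p l⊆ pl
⊆-filterᵇ p {x ∷ _} (refl ∷ l⊆) (px ∷ pl) with p x
... | true  = refl ∷ ⊆-filterᵇ p l⊆ pl

∈-cliques⁺ : {B : Set} (a : B → B → Bool) → ∀ h xs {l} → IsClique a h xs l → l ∈ cliques a h xs
∈-cliques⁺ a zero    xs       {[]}    _ = here refl
∈-cliques⁺ a (suc h) (x ∷ xs) (isClique (x ∷ʳ l⊆) adj size) =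
  ∈-++⁺ʳ (map (x ∷_) (cliques a h (nbrs a x xs))) (∈-cliques⁺ a (suc h) xs (isClique l⊆ adj size))
∈-cliques⁺ a (suc h) (x ∷ xs) (isClique (refl ∷ l⊆) (x∼l ∷ adj) size) =
  ∈-++⁺ˡ (∈-map⁺ (x ∷_) (∈-cliques⁺ a h (nbrs a x xs)
    (isClique (⊆-filterᵇ (a x) l⊆ x∼l) adj (suc-injective size))))

SameElements : {B : Set} → List B → List B → Set
SameElements l l′ = (∀ {x} → x ∈ l → x ∈ l′) × (∀ {x} → x ∈ l′ → x ∈ l)

-- Distinctness is needed as sets, since `completeOn` depends only on the set of entries. Lists from
-- the first half contain `x` and those from the second do not; within the first half `x` can be
-- cancelled.
cliques-distinct : {B : Set} (a : B → B → Bool) → ∀ h {xs} → Unique xs →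
  AllPairs (λ l l′ → ¬ SameElements l l′) (cliques a h xs)
cliques-distinct a zero    _  = [] ∷ []
cliques-distinct a (suc h) [] = []
cliques-distinct {B} a (suc h) {x ∷ xs} u@(_ ∷ xs!) = AllPairs.++⁺
  (AllPairs.map⁺ (AllPairs.zipWith cons-distinct
    ( All⇒AllPairs _,_ (All.tabulate x∉)
    , cliques-distinct a h (Uniq.filter⁺ (T? ∘ a x) xs!))))
  (cliques-distinct a (suc h) xs!)
  (All.map⁺ (All.universal (λ l → All.tabulate λ l′∈ (⊆ , _) →
    x∉xs (Sublist.lookup (IsClique.sublist (∈-cliques⁻ a (suc h) xs l′∈)) (⊆ (here refl)))) _))
  where
  x∉xs : x ∉ xs
  x∉xs = Unique[x∷xs]⇒x∉xs u
  x∉ : ∀ {l} → l ∈ cliques a h (nbrs a x xs) → x ∉ l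
  x∉ l∈ x∈l = x∉xs (proj₁ (∈-filter⁻ (T? ∘ a x) {xs = xs}
    (Sublist.lookup (IsClique.sublist (∈-cliques⁻ a h (nbrs a x xs) l∈)) x∈l)))
  uncons : ∀ {l l′ : List B} → x ∉ l → (∀ {y} → y ∈ x ∷ l → y ∈ x ∷ l′) → ∀ {y} → y ∈ l → y ∈ l′
  uncons x∉l ⊆ y∈l with ⊆ (there y∈l)
  ... | here refl   = ⊥-elim (x∉l y∈l)
  ... | there y∈l′  = y∈l′
  cons-distinct : ∀ {l l′ : List B} → (x ∉ l × x ∉ l′) × ¬ SameElements l l′ → ¬ SameElements (x ∷ l) (x ∷ l′)
  cons-distinct ((x∉l , x∉l′) , l≉l′) (⊆ , ⊇) = l≉l′ (uncons x∉l ⊆ , uncons x∉l′ ⊇)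

_∈ₗ?_ : ∀ {n} (v : Fin n) (l : List (Fin n)) → Dec (v ∈ l)
_∈ₗ?_ = DecMembership._∈?_ _≟_

Joined : ∀ {n} → List (Fin n) → Fin n → Fin n → Set
Joined l u v = u ≢ v × u ∈ l × v ∈ l

joined? : ∀ {n} (l : List (Fin n)) u v → Dec (Joined l u v)
joined? l u v = ¬? (u ≟ v) ×-dec (u ∈ₗ? l) ×-dec (v ∈ₗ? l)

completeOn : ∀ {n} → List (Fin n) → PreSubgraph n
completeOn l = Vec.tabulate (λ v → does (v ∈ₗ? l)) , Vec.tabulate (λ u → Vec.tabulate λ v → does (joined? l u v))

edge-completeOn : ∀ {n} (l : List (Fin n)) u v → edge (completeOn l) u v ≡ does (joined? l u v)
edge-completeOn l u v = trans
  (cong (λ row → Vec.lookup row v) (lookup∘tabulate (λ u → Vec.tabulate λ v → does (joined? l u v)) u))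
  (lookup∘tabulate (λ v → does (joined? l u v)) v)

edge-completeOn⁻ : ∀ {n} (l : List (Fin n)) {u v} → T (edge (completeOn l) u v) → Joined l u v
edge-completeOn⁻ l {u} {v} uv = T-does⁻ (joined? l u v) (subst T (edge-completeOn l u v) uv)

edge-completeOn⁺ : ∀ {n} (l : List (Fin n)) {u v} → Joined l u v → T (edge (completeOn l) u v)
edge-completeOn⁺ l {u} {v} uv = subst T (sym (edge-completeOn l u v)) (T-does⁺ (joined? l u v) uv)

V-completeOn⁻ : ∀ {n} (l : List (Fin n)) {v} → v Subset.∈ V (completeOn l) → v ∈ l
V-completeOn⁻ l {v} v∈ = T-does⁻ (v ∈ₗ? l) (≡true⇒T (trans (sym (lookup∘tabulate _ v)) ([]=⇒lookup v∈)))

V-completeOn⁺ : ∀ {n} (l : List (Fin n)) {v} → v ∈ l → v Subset.∈ V (completeOn l)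
V-completeOn⁺ l {v} v∈ = lookup⇒[]= v _ (trans (lookup∘tabulate _ v) (dec-true (v ∈ₗ? l) v∈))

T-adj-sym : ∀ {n} (G : Graph n) {u v} → Adj G u v → Adj G v u
T-adj-sym G {u} {v} = subst T (symm G u v)

Adj⇒≢ : ∀ {n} (G : Graph n) {u v} → Adj G u v → u ≢ v
Adj⇒≢ G {u} uv refl = subst T (irrefl G u) uv

completeOn-copy : ∀ {h n} {H : Graph h} {G : Graph n} → IsComplete H → ∀ {l} → AllPairs (Adj G) l →
  length l ≡ h → IsCopy H G (completeOn l)
completeOn-copy {n = n} {H} {G} complete {l} clique refl = isSubgraph
  (λ u v → T-ext (flip u v) (flip v u))
  (λ u v uv → let (u≢v , u∈ , v∈) = edge-completeOn⁻ l uv in AllPairs-∈ (T-adj-sym G) clique u∈ v∈ u≢v)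
  (λ u v uv → let (_ , u∈ , v∈) = edge-completeOn⁻ l uv in V-completeOn⁺ l u∈ , V-completeOn⁺ l v∈) ,
  lookup l , isIsomorphism
  (λ i j eq → case i ≟ j of λ { (yes i≡j) → i≡j ; (no i≢j) → ⊥-elim (distinct i≢j eq) })
  (λ i → V-completeOn⁺ l (∈-lookup i))
  (λ v v∈ → Any.index (V-completeOn⁻ l v∈) , sym (lookup-index (V-completeOn⁻ l v∈)))
  (λ i j → T-ext
    (λ ij → edge-completeOn⁺ l (distinct (Adj⇒≢ H ij) , ∈-lookup i , ∈-lookup j))
    (λ ij → complete i j (proj₁ (edge-completeOn⁻ l ij) ∘ cong (lookup l))))
  where
  flip : ∀ u v → T (edge (completeOn l) u v) → T (edge (completeOn l) v u)
  flip u v uv = let (u≢v , u∈ , v∈) = edge-completeOn⁻ l uv in edge-completeOn⁺ l (u≢v ∘ sym , v∈ , u∈)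
  distinct : ∀ {i j} → i ≢ j → lookup l i ≢ lookup l j
  distinct = AllPairs-lookup (λ x≢y → x≢y ∘ sym) (AllPairs.map (Adj⇒≢ G) clique)

preSubgraph-ext : ∀ {n} {X Y : PreSubgraph n} → (∀ v → Vec.lookup (V X) v ≡ Vec.lookup (V Y) v) →
  (∀ u v → edge X u v ≡ edge Y u v) → X ≡ Y
preSubgraph-ext {X = _ , _} {_ , _} V≡ edge≡ = cong₂ _,_ (vec-ext V≡) (vec-ext λ u → vec-ext (edge≡ u))
  where
  vec-ext : {A : Set} → ∀ {m} {xs ys : Vec A m} → (∀ i → Vec.lookup xs i ≡ Vec.lookup ys i) → xs ≡ ys
  vec-ext {xs = xs} {ys} eq = trans (sym (tabulate∘lookup xs)) (trans (tabulate-cong eq) (tabulate∘lookup ys))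

vertices : ∀ {n} → PreSubgraph n → List (Fin n)
vertices {n} X = filter (_∈? V X) (allFin n)

∈-vertices⁻ : ∀ {n} (X : PreSubgraph n) {v} → v ∈ vertices X → v Subset.∈ V X
∈-vertices⁻ {n} X v∈ = proj₂ (∈-filter⁻ (_∈? V X) {xs = allFin n} v∈)

∈-vertices⁺ : ∀ {n} (X : PreSubgraph n) {v} → v Subset.∈ V X → v ∈ vertices X
∈-vertices⁺ X v∈ = ∈-filter⁺ (_∈? V X) (∈-allFin _) v∈

copy-edge⁺ : ∀ {h n} {H : Graph h} {X : PreSubgraph n} → IsComplete H → H ≅ X → ∀ {u v} →
  u ≢ v → u Subset.∈ V X → v Subset.∈ V X → T (edge X u v)
copy-edge⁺ complete (φ , isIsomorphism _ _ onto edges) {u} {v} u≢v u∈ v∈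
  with i , refl ← onto u u∈ | j , refl ← onto v v∈ = subst T (edges i j) (complete i j (u≢v ∘ cong φ))

-- Listing the vertices in the order of `allFin n` yields a sublist; its length is `h` because the
-- isomorphism enumerates the same set.
copy-clique : ∀ {h n} {H : Graph h} {G : Graph n} → IsComplete H → ∀ {X} → IsCopy H G X →
  IsClique (adj G) h (allFin n) (vertices X)
copy-clique {h} {n} {H} {G} complete {X} (isSubgraph _ edge⊆G _ , H≅X@(φ , isIsomorphism inj into onto edges)) =
  isClique (filter-⊆ (_∈? V X) (allFin n))
    (AllPairs.zipWith (λ ((u∈ , v∈) , u≢v) → edge⊆G _ _ (copy-edge⁺ complete H≅X u≢v u∈ v∈))
      (All⇒AllPairs _,_ (All.all-filter (_∈? V X) (allFin n)) , Uniq.filter⁺ (_∈? V X) (allFin⁺ n)))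
    (trans (unique-length (Uniq.filter⁺ (_∈? V X) (allFin⁺ n)) (tabulate⁺ (λ {i} {j} → inj i j))
             (λ v∈ → let (i , φi≡v) = onto _ (∈-vertices⁻ X v∈) in subst (_∈ tabulate φ) φi≡v (∈-tabulate⁺ i))
             (λ v∈ → let (i , v≡φi) = ∈-tabulate⁻ v∈ in ∈-vertices⁺ X (subst (Subset._∈ V X) (sym v≡φi) (into i))))
           (length-tabulate φ))

-- In a copy of a complete graph every two vertices are joined and edges have both ends in the
-- vertex set, so the vertex set determines the copy.
copy-completeOn : ∀ {h n} {H : Graph h} {G : Graph n} → IsComplete H → ∀ {X} → IsCopy H G X →
  X ≡ completeOn (vertices X)
copy-completeOn {G = G} complete {X} (isSubgraph _ edge⊆G edge-ends , H≅X) = preSubgraph-ext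
  (λ v → T-ext
    (λ v∈ → ≡true⇒T ([]=⇒lookup (V-completeOn⁺ (vertices X) (∈-vertices⁺ X (lookup⇒[]= v _ (T⇒≡true v∈))))))
    (λ v∈ → ≡true⇒T ([]=⇒lookup (∈-vertices⁻ X (V-completeOn⁻ (vertices X) (lookup⇒[]= v _ (T⇒≡true v∈)))))))
  (λ u v → T-ext
    (λ uv → let (u∈ , v∈) = edge-ends u v uv in
      edge-completeOn⁺ (vertices X) (Adj⇒≢ G (edge⊆G u v uv) , ∈-vertices⁺ X u∈ , ∈-vertices⁺ X v∈))
    (λ uv → let (u≢v , u∈ , v∈) = edge-completeOn⁻ (vertices X) uv in
      copy-edge⁺ complete H≅X u≢v (∈-vertices⁻ X u∈) (∈-vertices⁻ X v∈)))

-- `vertices` and `completeOn` match copies with cliques, each clique being listed once, as a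
-- sublist of `allFin n`.
𝓝≡cw : ∀ {h n} {H : Graph h} (G : Graph n) → IsComplete H → 𝓝 H G ≡ cw (adj G) (const 1) h (allFin n)
𝓝≡cw {h} {n} {H} G complete = begin
  length (filter (isCopy? H G) (allPreSubgraphs n))
    ≡⟨ unique-length (Uniq.filter⁺ (isCopy? H G) (allPreSubgraphs-unique n)) unique from to ⟩
  length (map completeOn (cliques (adj G) h (allFin n)))
    ≡⟨ length-map completeOn (cliques (adj G) h (allFin n)) ⟩
  length (cliques (adj G) h (allFin n))
    ≡⟨ length-cliques (adj G) h (allFin n) ⟩
  cw (adj G) (const 1) h (allFin n)  ∎
  where
  open ≡-Reasoning
  same : ∀ {l l′ : List (Fin n)} → completeOn l ≡ completeOn l′ → SameElements l l′
  same {l} {l′} eq = (λ x∈ → V-completeOn⁻ l′ (subst (λ X → _ Subset.∈ V X) eq (V-completeOn⁺ l x∈)))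
                   , (λ x∈ → V-completeOn⁻ l (subst (λ X → _ Subset.∈ V X) (sym eq) (V-completeOn⁺ l′ x∈)))
  unique : Unique (map completeOn (cliques (adj G) h (allFin n)))
  unique = AllPairs.map⁺ (AllPairs.map (λ l≉l′ eq → l≉l′ (same eq)) (cliques-distinct (adj G) h (allFin⁺ n)))
  from : ∀ {X} → X ∈ filter (isCopy? H G) (allPreSubgraphs n) → X ∈ map completeOn (cliques (adj G) h (allFin n))
  from X∈ with copy ← proj₂ (∈-filter⁻ (isCopy? H G) {xs = allPreSubgraphs n} X∈) =
    subst (_∈ map completeOn _) (sym (copy-completeOn complete copy))
          (∈-map⁺ completeOn (∈-cliques⁺ (adj G) h (allFin n) (copy-clique complete copy)))
  to : ∀ {X} → X ∈ map completeOn (cliques (adj G) h (allFin n)) → X ∈ filter (isCopy? H G) (allPreSubgraphs n)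
  to X∈ with l , l∈ , refl ← ∈-map⁻ completeOn X∈
        with isClique _ clique size ← ∈-cliques⁻ (adj G) h (allFin n) l∈ =
    ∈-filter⁺ (isCopy? H G) (∈-allPreSubgraphs _) (completeOn-copy complete clique size)

-- The upper bound and its attainment.

K-complete : ∀ m → IsComplete (K m)
K-complete m u v u≢v = ≡true⇒T (cong not (dec-false (u ≟ v) u≢v))

free⇒clique< : ∀ {m n} {G : Graph n} → Free (K m) G → ∀ {l} → AllPairs (Adj G) l → length l < m
free⇒clique< {m} free {l} clique = ≰⇒> λ m≤ → free (_ , completeOn-copy (K-complete m)
  (AllPairs.take⁺ m clique) (trans (length-take m l) (m≤n⇒m⊓n≡m m≤)))

-- By pigeonhole two of the `m` vertices of a copy lie in one part, yet they would have to be
-- adjacent.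
Turán-free : ∀ r .{{_ : NonZero r}} {m n} {T : Graph n} → r < m → IsTurán r T → Free (K m) T
Turán-free r {m} r<m tur (X , isSubgraph _ edge⊆T _ , φ , isIsomorphism _ _ _ edges)
  with i , j , i<j , same ← pigeonhole r<m (IsTurán.part tur ∘ φ) =
  proj₁ (IsTurán.adj⇔ tur (φ i) (φ j)) (edge⊆T _ _ (subst T (edges i j) (K-complete m i j (<⇒≢ i<j)))) same

𝓝≡cw′ : ∀ {h n} {H : Graph h} (G : Graph n) → IsComplete H → 2 ≤ h →
  𝓝 H G ≡ cw (adj G) (const 1) (2 + (h ∸ 2)) (allFin n)
𝓝≡cw′ {n = n} G complete 2≤h =
  trans (𝓝≡cw G complete) (cong (λ d → cw (adj G) (const 1) d (allFin n)) (sym (m+[n∸m]≡n 2≤h)))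

map-lookup-allFin : {B : Set} (xs : List B) → map (lookup xs) (allFin (length xs)) ≡ xs
map-lookup-allFin xs = trans (map-tabulate id (lookup xs)) (tabulate-lookup xs)

-- On the positions of `ys` the graph is complete, so the colours of the pairs form a `Colouring`
-- there and the recolouring bound applies.
weightedTotal≤e : ∀ {n k} {G : Graph n} (c : EdgeColouring k G) → Fin k → ∀ g (ys : List (Fin n × ℕ)) →
  AllPairs (λ x y → T (on₁ (adj G) x y)) ys → All (λ x → 0 < proj₂ x) ys →
  ∃ λ i → weightedTotal (adj ∘ colourClass G c) g ys ≤ e (2 + g i) (map proj₂ ys)
weightedTotal≤e {G = G} c i₀ g ys clique positive = i , (begin
  weightedTotal (adj ∘ colourClass G c) g ys                       ≡⟨ ∑-cong same ⟩
  total (hue shade) w g (allFin (length ys))                       ≤⟨ le ⟩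
  e (2 + g i) (map w (allFin (length ys)))                         ≡⟨ cong (e (2 + g i)) (map-∘ (allFin (length ys))) ⟩
  e (2 + g i) (map proj₂ (map (lookup ys) (allFin (length ys))))   ≡⟨ cong (e (2 + g i) ∘ map proj₂) (map-lookup-allFin ys) ⟩
  e (2 + g i) (map proj₂ ys)                                       ∎)
  where
  open ≤-Reasoning
  vertex : Fin (length ys) → _
  vertex x = proj₁ (lookup ys x)
  w : Fin (length ys) → ℕ
  w x = proj₂ (lookup ys x)
  shade : Fin (length ys) → Fin (length ys) → _
  shade x y = colour c (vertex x) (vertex y)
  adjacent : ∀ {x y} → x ≢ y → Adj G (vertex x) (vertex y)
  adjacent = AllPairs-lookup (T-adj-sym G) clique
  shade-symm : Symm shade
  shade-symm x y = case x ≟ y of λ where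
    (yes refl) → refl
    (no x≢y)   → colour-symm c (vertex x) (vertex y) (adjacent x≢y)
  bound = total≤e i₀ (shade , shade-symm) (λ x → All.lookup positive (∈-lookup x)) g
  i = proj₁ bound
  le = proj₂ bound
  same : ∀ i → cw (on₁ (adj (colourClass G c i))) proj₂ (2 + g i) ys ≡
               cw (hue shade i) w (2 + g i) (allFin (length ys))
  same i = trans (cong (cw (on₁ (adj (colourClass G c i))) proj₂ (2 + g i)) (sym (map-lookup-allFin ys)))
    (trans (cw-map (lookup ys) (on₁ (adj (colourClass G c i))) proj₂ (2 + g i) (allFin (length ys)))
      (cw-cong w (2 + g i) (AllPairs.map
        (λ {x} {y} x≢y → cong (_∧ hue shade i x y) (T⇒≡true (adjacent x≢y))) (allFin⁺ (length ys)))))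

-- The colour `i` is found by the recolouring and varies with `G` and `c`, hence the existential in
-- place of a maximum.
upper-bound : ∀ {n k} {h : Fin k → ℕ} (H : ∀ i → Graph (h i)) → (∀ i → IsComplete (H i)) → (∀ i → 2 ≤ h i) →
  ∀ r .{{_ : NonZero r}} {T : Graph n} → IsTurán r T → Fin k → (G : Graph n) (c : EdgeColouring k G) → Free (K (suc r)) G → ∃ λ i → colouredCount H G c ≤ 𝓝 (H i) T
upper-bound {n} {k} {h} H complete 2≤h r {T} tur i₀ G c free = i , (begin
  colouredCount H G c                    ≡⟨ ∑-cong (λ j → 𝓝≡cw′ (colourClass G c j) (complete j) (2≤h j)) ⟩
  total a (const 1) g (allFin n)
    ≡⟨ ∑-cong (λ j → sym (cw-map (_, 1) (on₁ (a j)) proj₂ (2 + g j) (allFin n))) ⟩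
  weightedTotal a g (map (_, 1) (allFin n))   ≤⟨ gain ⟩
  weightedTotal a g support              ≤⟨ proj₂ bound ⟩
  e (2 + g i) (map proj₂ support)        ≤⟨ e≤cw-Turán r tur (2 + g i) (map proj₂ support) few total-mass ⟩
  cw (adj T) (const 1) (2 + g i) (allFin n)   ≡⟨ 𝓝≡cw′ T (complete i) (2≤h i) ⟨
  𝓝 (H i) T                              ∎)
  where
  open ≤-Reasoning
  a : Fin k → Fin n → Fin n → Bool
  a j = adj (colourClass G c j)
  g : Fin k → ℕ
  g j = h j ∸ 2
  open CliqueSupported (concentrate (adj G) a g (λ j → symm (colourClass G c j))
    (λ j p q ¬pq → cong (_∧ does (colour c p q ≟ j)) (¬T⇒≡false ¬pq))
    (map (_, 1) (allFin n)) (All.map⁺ (All.universal (λ _ → s≤s z≤n) (allFin n))))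
  bound = weightedTotal≤e c i₀ g support clique positive
  i = proj₁ bound
  -- The support is a clique of a `K (suc r)`-free graph, so its weights fit into `r` parts.
  few : length (map proj₂ support) ≤ r
  few = ≤-trans (≤-reflexive (trans (length-map proj₂ support) (sym (length-map proj₁ support))))
                (s≤s⁻¹ (free⇒clique< free (AllPairs.map⁺ clique)))
  sum-ones : ∀ (xs : List (Fin n)) → sum (map proj₂ (map (_, 1) xs)) ≡ length xs
  sum-ones []       = refl
  sum-ones (x ∷ xs) = cong suc (sum-ones xs)
  total-mass : sum (map proj₂ support) ≡ n
  total-mass = trans mass (trans (sum-ones (allFin n)) (length-tabulate id))

-- All other colour classes are edgeless, while a clique counted in them has at least two vertices;
-- colour `i` carries all of `T`.
colouredCount-monochromatic : ∀ {n k} {h : Fin k → ℕ} (H : ∀ i → Graph (h i)) → (∀ i → IsComplete (H i)) →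
  (∀ i → 2 ≤ h i) → ∀ (T : Graph n) i → colouredCount H T (monochromatic T i) ≡ 𝓝 (H i) T
colouredCount-monochromatic {n} {h = h} H complete 2≤h T i = trans
  (∑-single i λ j j≢i → trans (𝓝≡cw′ (mono j) (complete j) (2≤h j)) (cw-edgeless (const 1) (h j ∸ 2)
    (AllPairs.map (λ {u} {v} _ → trans (cong (adj T u v ∧_) (dec-false (i ≟ j) (j≢i ∘ sym))) (∧-zeroʳ _))
                  (allFin⁺ n))))
  (trans (𝓝≡cw′ (mono i) (complete i) (2≤h i)) (trans
    (cw-cong (const 1) (2 + (h i ∸ 2)) (AllPairs.map
      (λ {u} {v} _ → trans (cong (adj T u v ∧_) (dec-true (i ≟ i) refl)) (∧-identityʳ _)) (allFin⁺ n)))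
    (sym (𝓝≡cw′ T (complete i) (2≤h i)))))
  where
  mono = colourClass T (monochromatic T i)

max-attained : ∀ {k} → Fin k → (f : Fin k → ℕ) → ∃ λ i → f i ≡ max 0 (tabulate f)
max-attained i₀ f with argmax-sel id 0 (tabulate f)
... | inj₂ max∈   = let (i , max≡fi) = ∈-tabulate⁻ max∈ in i , sym max≡fi
-- The default `0` is the maximum, so every value is zero and any colour attains it.
... | inj₁ max≡0  = i₀ , ≤-antisym (≤max i₀) (≤-trans (≤-reflexive max≡0) z≤n)
  where
  ≤max : ∀ i → f i ≤ max 0 (tabulate f)
  ≤max i = All.lookup (xs≤max 0 (tabulate f)) (∈-tabulate⁺ i)

mainTheorem8 : ∀ (m : ℕ) (2≤m : 2 ≤ m) (k : ℕ) → 1 ≤ k →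
    (h : Fin k → ℕ) (H : ∀ i → Graph (h i)) →
    (∀ i → IsComplete (H i)) → (∀ i → 2 ≤ h i) →
    (n : ℕ) (T : Graph n) → IsTurán (m ∸ 1) {{>-nonZero (m<n⇒0<n∸m 2≤m)}} T →
    let M = max 0 (tabulate λ i → 𝓝 (H i) T) in
    IsExCol n H (K m) M ×
    Free (K m) T × (∃[ i ] colouredCount H T (monochromatic T i) ≡ M)
mainTheorem8 (suc r) 2≤m k 1≤k h H complete 2≤h n T tur = record
  { attained   = T , monochromatic T best , free , attains
  ; upperBound = λ G c G-free → let (i , le) = upper-bound H complete 2≤h r tur (fromℕ< 1≤k) G c G-free in
      ≤-trans le (All.lookup (xs≤max 0 (tabulate λ i → 𝓝 (H i) T)) (∈-tabulate⁺ i))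
  } , free , best , attains
  where
  instance r≢0 : NonZero r
           r≢0 = >-nonZero (m<n⇒0<n∸m 2≤m)
  free : Free (K (suc r)) T
  free = Turán-free r ≤-refl tur
  best = proj₁ (max-attained (fromℕ< 1≤k) λ i → 𝓝 (H i) T)
  attains : colouredCount H T (monochromatic T best) ≡ max 0 (tabulate λ i → 𝓝 (H i) T)
  attains = trans (colouredCount-monochromatic H complete 2≤h T best)
                  (proj₂ (max-attained (fromℕ< 1≤k) λ i → 𝓝 (H i) T))
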